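{- Let $C$ be a sufficiently large constant. Set $n_1=2^C$, $n_i=n_{i-1}^4$ for $i>1$, and $m_i=n_i^{100}$ for $i\ge 1$. Set $p_1=0.6$ and $p_i=p_{i-1}+1/(10i^2)$ for $i>1$. Let $t\ge 1$ be an integer and let $\{Q_{i,j}\}_{1\le j\le i\le t}$ be randomized communication protocols such that: - In each $Q_{i,j}$, Alice receives $\vec X=(X_1,\dots,X_t)$ and Bob receives $\vec Y=(Y_1,\dots,Y_t)$, where each $(X_\ell,Y_\ell)$ is an instance of $\textsc{XOR-Missing-String}(n_\ell,m_\ell)$. - The complexity of each $Q_{i,j}$ is at most $n_i^4$, and $Q_{i,j}$ outputs a string of length $n_i$. Then there is a choice of inputs $\{(X_\ell,Y_\ell)\}_{\ell\le t}$ such that, for every $1\le j\le i\le t$, one of the following holds: - no string is output by $Q_{i,j}(\vec X,\vec Y)$ with probability greater than $p_t$; or - the unique string output by $Q_{i,j}(\vec X,\vec Y)$ with probability greater than $p_t$ is not a solution to $\textsc{XOR-Missing-String}$ on $(X_i,Y_i)$.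
   Context: $\textsc{XOR-Missing-String}(n,m)$, for $m<2^{n/2}$: Alice gets $X=(x_1,\dots,x_m)$ and Bob gets $Y=(y_1,\dots,y_m)$, with all strings in $\{0,1\}^n$. A string $s\in\{0,1\}^n$ is a solution on $(X,Y)$ if $s\ne x_i\oplus y_j$ for all $i,j$. A randomized communication protocol uses public randomness. Its complexity is the maximum number of bits communicated plus the number of random bits used. -}

module Defs where

open import Data.Bool using (Bool; true; false; _xor_)
open import Data.Bool.Properties using () renaming (_≟_ to _≟B_)
open import Data.Nat using (ℕ; zero; suc; _+_; _*_; _^_; _⊔_)
open import Data.Nat.Properties using (m^n≢0)
open import Data.Integer using (+_)
open import Data.Rational using (ℚ; _/_; _<_) renaming (_+_ to _+ℚ_)
open import Data.Fin using (Fin; toℕ)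
open import Data.Vec using (Vec; []; _∷_; zipWith; lookup)
open import Data.Vec.Properties using (≡-dec)
open import Data.List using (List; []; _∷_; map; filter; length; foldr; _++_)
open import Relation.Binary.PropositionalEquality using (_≡_; _≢_)
open import Relation.Nullary using (¬_)
open import Data.Sum using (_⊎_)

BitString : ℕ → Set
BitString n = Vec Bool n

_⊕_ : ∀ {n} → BitString n → BitString n → BitString n
_⊕_ = zipWith _xor_

IsSolution : ∀ {n m} → BitString n → Vec (BitString n) m → Vec (BitString n) m → Set
IsSolution s X Y = ∀ a b → s ≢ (lookup X a ⊕ lookup Y b)

allStrings : (r : ℕ) → List (BitString r)
allStrings zero = [] ∷ []
allStrings (suc r) = map (true ∷_) (allStrings r) ++ map (false ∷_) (allStrings r)

-- Parameters (paper indices are 1-based; here index k stands for k+1)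

N : ℕ → ℕ → ℕ
N C zero = 2 ^ C
N C (suc k) = N C k ^ 4

M : ℕ → ℕ → ℕ
M C k = N C k ^ 100

P : ℕ → ℚ
P zero = (+ 6) / 10
P (suc k) = P k +ℚ ((+ 1) / (10 * (suc (suc k) * suc (suc k))))

data Protocol (A B O : Set) : Set where
  leaf  : O → Protocol A B O
  alice : (A → Bool) → Protocol A B O → Protocol A B O → Protocol A B O
  bob   : (B → Bool) → Protocol A B O → Protocol A B O → Protocol A B O

depth : ∀ {A B O} → Protocol A B O → ℕ
depth (leaf _) = 0
depth (alice _ l r) = suc (depth l ⊔ depth r)
depth (bob _ l r) = suc (depth l ⊔ depth r)

run : ∀ {A B O} → Protocol A B O → A → B → O
run (leaf o) x y = o
run (alice f l r) x y with f x
... | true = run l x y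
... | false = run r x y
run (bob g l r) x y with g y
... | true = run l x y
... | false = run r x y

-- Public-coin randomized protocol: `bits` uniformly random public bits,
-- then a deterministic protocol depending on them.
record RandProtocol (A B O : Set) : Set where
  field
    bits  : ℕ
    proto : BitString bits → Protocol A B O
open RandProtocol public

complexity : ∀ {A B O} → RandProtocol A B O → ℕ
complexity Q = bits Q + foldr _⊔_ 0 (map (λ ρ → depth (proto Q ρ)) (allStrings (bits Q)))

Pr : ∀ {A B n} → RandProtocol A B (BitString n) → A → B → BitString n → ℚ
Pr {n = n} Q x y s =
  _/_ (+ length (filter (λ ρ → ≡-dec _≟B_ (run (proto Q ρ) x y) s) (allStrings (bits Q))))
      (2 ^ bits Q) {{m^n≢0 2 (bits Q)}}

Inputs : ℕ → ℕ → Set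
Inputs C t = (ℓ : Fin t) → Vec (BitString (N C (toℕ ℓ))) (M C (toℕ ℓ))

Conclusion : ∀ {A B n m} → RandProtocol A B (BitString n) → A → B → ℚ →
             Vec (BitString n) m → Vec (BitString n) m → Set
Conclusion Q x y p Xi Yi =
  (∀ s → ¬ (p < Pr Q x y s)) ⊎
  (∀ s → p < Pr Q x y s → ¬ IsSolution s Xi Yi)

{-# OPTIONS --safe #-}

-- Induct on t. For each value u of the last instance the induction hypothesis yields values W of the
-- earlier ones that are bad for the earlier protocols at threshold p_{t-1} (with p_0 = 1/2); let s_j be
-- the string that Q_{t,j}(W, u) outputs with probability > p_{t-1}, if any. Some colour (W, s) is shared
-- by a set G of u of density 2^{-poly(n_t)}. Planting s in u, i.e. forcing y_a = x_a ⊕ s for a whole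
-- block a of strings, makes every s_j a non-solution. It remains to find a planted input on which every
-- other relevant string (a solution for W, or one different from s_j) has probability at most p_t,
-- given that on G it has probability at most p_{t-1}.
--
-- Run every protocol k + 1 times and reject if all runs of one of them agree on a relevant string. With
-- k of order t³, rejection is at least twice as likely on an input violating p_t as on G. So after
-- K = 2^k L repetitions the acceptance probabilities differ by a factor 2^L, which beats the density of G.
-- The acceptance probability is a sum of 2^{poly(n_t)} rectangles, where the exponent is far below the
-- number n_t^{99} of blocks. Rectangles A × B that are not tiny have to contain many planted inputs:
-- otherwise, up to constant factors and after discarding words with a rare letter, A and B lie in
-- products of sets of letters that are disjoint after the shift by s, and A × B has density 4^{-n_t^{99}}.
module Submission where

open import Defs
open import Data.Bool using (Bool; true; false; if_then_else_; not; _∧_; _xor_)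
open import Data.Bool.Properties using () renaming (_≟_ to _≟B_)
open import Data.Nat
open import Data.Nat.Properties
open import Data.Nat.Tactic.RingSolver using (solve-∀)
import Data.Integer as ℤ
import Data.Integer.Properties as ℤ
import Data.Rational as ℚ
import Data.Rational.Properties as ℚ
import Data.Rational.Unnormalised as ℚᵘ
import Data.Rational.Unnormalised.Properties as ℚᵘ
open import Data.Fin using (Fin; zero; suc; toℕ; fromℕ<; inject≤; combine; remQuot)
open import Data.Fin.Properties
  using (any?; all?; toℕ<n; toℕ-inject≤; toℕ-fromℕ<; remQuot-combine)
open import Data.List
  using (List; []; _∷_; length; map; concatMap; filter; foldr; allFin; _++_; cartesianProductWith)
open import Data.List.Properties using (length-map; length-++; length-tabulate)
open import Data.List.Membership.Propositional using (_∈_; lose)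
open import Data.List.Membership.Propositional.Properties
  using (∈-allFin; ∈-++⁺ˡ; ∈-++⁺ʳ; ∈-++⁻; ∈-map⁺; ∈-map⁻; ∈-cartesianProductWith⁺; ∈-cartesianProductWith⁻)
open import Data.List.Relation.Unary.Any as Any using (here; there)
open import Data.Vec using (Vec; []; _∷_; lookup; zipWith; tabulate; replicate)
open import Data.Vec.Properties using (≡-dec; lookup∘tabulate; lookup-zipWith)
open import Data.Product using (∃; ∃-syntax; _×_; _,_; proj₁; proj₂)
open import Data.Sum using (inj₂; [_,_]′)
open import Data.Unit using (⊤; tt)
open import Function using (_∘_)
open import Relation.Nullary using (¬_; Dec; yes; no; does; ¬?; _×-dec_; contradiction)
open import Relation.Nullary.Decidable using (dec-true; dec-false)
open import Relation.Unary using (Decidable)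
open import Relation.Binary using (DecidableEquality)
open import Relation.Binary.PropositionalEquality
import Relation.Binary.Reasoning.Setoid as SetoidReasoning

private variable
  A B C A′ B′ O I Σ : Set
  m s s′ S budget : ℕ
  φ ψ : A → B → ℕ

-- Finite sums and products

^-distribʳ-* : ∀ k x y → (x * y) ^ k ≡ x ^ k * y ^ k
^-distribʳ-* zero    x y = refl
^-distribʳ-* (suc k) x y rewrite ^-distribʳ-* k x y = interchange x y (x ^ k) (y ^ k)
  where
  interchange : ∀ a b c d → a * b * (c * d) ≡ a * c * (b * d)
  interchange = solve-∀

∑ : List A → (A → ℕ) → ℕ
∑ []       f = 0
∑ (x ∷ xs) f = f x + ∑ xs f

∑-cong : ∀ (xs : List A) {f g : A → ℕ} → (∀ x → f x ≡ g x) → ∑ xs f ≡ ∑ xs g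
∑-cong []       f≡g = refl
∑-cong (x ∷ xs) f≡g = cong₂ _+_ (f≡g x) (∑-cong xs f≡g)

∑-mono : ∀ (xs : List A) {f g : A → ℕ} → (∀ x → f x ≤ g x) → ∑ xs f ≤ ∑ xs g
∑-mono []       f≤g = z≤n
∑-mono (x ∷ xs) f≤g = +-mono-≤ (f≤g x) (∑-mono xs f≤g)

∑-+ : ∀ (xs : List A) (f g : A → ℕ) → ∑ xs (λ x → f x + g x) ≡ ∑ xs f + ∑ xs g
∑-+ []       f g = refl
∑-+ (x ∷ xs) f g rewrite ∑-+ xs f g = lemma (f x) (g x) (∑ xs f) (∑ xs g)
  where
  lemma : ∀ p q r s → p + q + (r + s) ≡ p + r + (q + s)
  lemma = solve-∀

∑-*ˡ : ∀ (xs : List A) k (f : A → ℕ) → ∑ xs (λ x → k * f x) ≡ k * ∑ xs f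
∑-*ˡ []       k f = sym (*-zeroʳ k)
∑-*ˡ (x ∷ xs) k f rewrite ∑-*ˡ xs k f = sym (*-distribˡ-+ k (f x) (∑ xs f))

∑-*ʳ : ∀ (xs : List A) k (f : A → ℕ) → ∑ xs (λ x → f x * k) ≡ ∑ xs f * k
∑-*ʳ []       k f = refl
∑-*ʳ (x ∷ xs) k f rewrite ∑-*ʳ xs k f = sym (*-distribʳ-+ k (f x) (∑ xs f))

∑-const : ∀ (xs : List A) k → ∑ xs (λ _ → k) ≡ length xs * k
∑-const []       k = refl
∑-const (x ∷ xs) k = cong (k +_) (∑-const xs k)

∑-zero : ∀ (xs : List A) → ∑ xs (λ _ → 0) ≡ 0
∑-zero xs = trans (∑-const xs 0) (*-zeroʳ (length xs))

∑-swap : ∀ (xs : List A) (ys : List B) (f : A → B → ℕ) →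
         ∑ xs (λ x → ∑ ys (f x)) ≡ ∑ ys (λ y → ∑ xs (λ x → f x y))
∑-swap []       ys f = sym (∑-zero ys)
∑-swap (x ∷ xs) ys f rewrite ∑-swap xs ys f =
  sym (∑-+ ys (f x) (λ y → ∑ xs (λ x′ → f x′ y)))

∑-++ : ∀ (xs ys : List A) (f : A → ℕ) → ∑ (xs ++ ys) f ≡ ∑ xs f + ∑ ys f
∑-++ []       ys f = refl
∑-++ (x ∷ xs) ys f rewrite ∑-++ xs ys f = sym (+-assoc (f x) (∑ xs f) (∑ ys f))

∑-map : ∀ (g : A → B) (xs : List A) (f : B → ℕ) → ∑ (map g xs) f ≡ ∑ xs (f ∘ g)
∑-map g []       f = refl
∑-map g (x ∷ xs) f = cong (f (g x) +_) (∑-map g xs f)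

∑-cartesian : ∀ (h : A → B → C) (xs : List A) (ys : List B) (f : C → ℕ) →
              ∑ (cartesianProductWith h xs ys) f ≡ ∑ xs (λ x → ∑ ys (λ y → f (h x y)))
∑-cartesian h []       ys f = refl
∑-cartesian h (x ∷ xs) ys f = begin
  ∑ (map (h x) ys ++ cartesianProductWith h xs ys) f
    ≡⟨ ∑-++ (map (h x) ys) _ f ⟩
  ∑ (map (h x) ys) f + ∑ (cartesianProductWith h xs ys) f
    ≡⟨ cong₂ _+_ (∑-map (h x) ys f) (∑-cartesian h xs ys f) ⟩
  ∑ ys (f ∘ h x) + ∑ xs (λ x′ → ∑ ys (λ y → f (h x′ y))) ∎
  where open ≡-Reasoning

∑-* : ∀ (xs : List A) (ys : List B) (f : A → ℕ) (g : B → ℕ) →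
      ∑ xs (λ x → ∑ ys (λ y → f x * g y)) ≡ ∑ xs f * ∑ ys g
∑-* xs ys f g = trans (∑-cong xs (λ x → ∑-*ˡ ys (f x) g)) (∑-*ʳ xs (∑ ys g) f)

∈⇒≤∑ : ∀ {x : A} {xs : List A} → x ∈ xs → (f : A → ℕ) → f x ≤ ∑ xs f
∈⇒≤∑ (here refl) f = m≤m+n _ _
∈⇒≤∑ (there x∈)  f = ≤-trans (∈⇒≤∑ x∈ f) (m≤n+m _ _)

∑-<⇒∃ : ∀ (xs : List A) (f g : A → ℕ) → ∑ xs f < ∑ xs g → ∃ λ x → f x < g x
∑-<⇒∃ (x ∷ xs) f g Σf<Σg with f x <? g x
... | yes fx<gx = x , fx<gx
... | no  fx≮gx = ∑-<⇒∃ xs f g (+-cancelˡ-< (f x) _ _ (<-≤-trans Σf<Σg (+-monoˡ-≤ _ (≮⇒≥ fx≮gx))))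

length-∑ : ∀ (xs : List A) → length xs ≡ ∑ xs (λ _ → 1)
length-∑ []       = refl
length-∑ (x ∷ xs) = cong suc (length-∑ xs)

length-cartesian : ∀ (h : A → B → C) xs ys →
                   length (cartesianProductWith h xs ys) ≡ length xs * length ys
length-cartesian h []       ys = refl
length-cartesian h (x ∷ xs) ys = begin
  length (map (h x) ys ++ cartesianProductWith h xs ys)
    ≡⟨ length-++ (map (h x) ys) ⟩
  length (map (h x) ys) + length (cartesianProductWith h xs ys)
    ≡⟨ cong₂ _+_ (length-map (h x) ys) (length-cartesian h xs ys) ⟩
  length ys + length xs * length ys ∎
  where open ≡-Reasoning

ι : Bool → ℕ
ι b = if b then 1 else 0

ι≤1 : ∀ b → ι b ≤ 1
ι≤1 true  = s≤s z≤n
ι≤1 false = z≤n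

ι+ι-not : ∀ b → ι b + ι (not b) ≡ 1
ι+ι-not true  = refl
ι+ι-not false = refl

ι-∧ : ∀ b c → ι (b ∧ c) ≡ ι b * ι c
ι-∧ true  c = sym (+-identityʳ (ι c))
ι-∧ false c = refl

vecs : List A → (m : ℕ) → List (Vec A m)
vecs E zero    = [] ∷ []
vecs E (suc m) = cartesianProductWith _∷_ E (vecs E m)

length-vecs : ∀ (E : List A) m → length (vecs E m) ≡ length E ^ m
length-vecs E zero    = refl
length-vecs E (suc m) = trans (length-cartesian _∷_ E (vecs E m)) (cong (length E *_) (length-vecs E m))

∈-vecs : ∀ {E : List A} → (∀ x → x ∈ E) → ∀ {m} (v : Vec A m) → v ∈ vecs E m
∈-vecs x∈E []      = here refl
∈-vecs x∈E (x ∷ v) = ∈-cartesianProductWith⁺ _∷_ (x∈E x) (∈-vecs x∈E v)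

∏ : ∀ {m} → (Fin m → ℕ) → ℕ
∏ {zero}  f = 1
∏ {suc m} f = f zero * ∏ (f ∘ suc)

∏-mono : ∀ {m} {f g : Fin m → ℕ} → (∀ i → f i ≤ g i) → ∏ f ≤ ∏ g
∏-mono {zero}  f≤g = ≤-refl
∏-mono {suc m} f≤g = *-mono-≤ (f≤g zero) (∏-mono (f≤g ∘ suc))

∏-* : ∀ {m} (f g : Fin m → ℕ) → ∏ (λ i → f i * g i) ≡ ∏ f * ∏ g
∏-* {zero}  f g = refl
∏-* {suc m} f g rewrite ∏-* (f ∘ suc) (g ∘ suc) = lemma (f zero) (g zero) _ _
  where
  lemma : ∀ p q r s → p * q * (r * s) ≡ p * r * (q * s)
  lemma = solve-∀

∏-const : ∀ m k → ∏ {m} (λ _ → k) ≡ k ^ m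
∏-const zero    k = refl
∏-const (suc m) k = cong (k *_) (∏-const m k)

-- Expanding the product term by term is the distributive law. With indicators `f i` it counts the
-- words of a product of sets of letters.
∑-vecs-∏ : ∀ (E : List A) m (f : Fin m → A → ℕ) →
           ∑ (vecs E m) (λ v → ∏ (λ i → f i (lookup v i))) ≡ ∏ (λ i → ∑ E (f i))
∑-vecs-∏ E zero    f = refl
∑-vecs-∏ E (suc m) f = begin
  ∑ (vecs E (suc m)) (λ v → ∏ (λ i → f i (lookup v i)))
    ≡⟨ ∑-cartesian _∷_ E (vecs E m) _ ⟩
  ∑ E (λ z → ∑ (vecs E m) (λ v → f zero z * ∏ (λ i → f (suc i) (lookup v i))))
    ≡⟨ ∑-* E (vecs E m) (f zero) _ ⟩
  ∑ E (f zero) * ∑ (vecs E m) (λ v → ∏ (λ i → f (suc i) (lookup v i)))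
    ≡⟨ cong (∑ E (f zero) *_) (∑-vecs-∏ E m (f ∘ suc)) ⟩
  ∑ E (f zero) * ∏ (λ i → ∑ E (f (suc i))) ∎
  where open ≡-Reasoning

-- Expresses that `π` permutes the list `E`. The form by test functions rewrites sums directly and
-- passes to coordinatewise maps.
Invariant : List A → (A → A) → Set
Invariant {A = A} E π = ∀ (f : A → ℕ) → ∑ E (f ∘ π) ≡ ∑ E f

-- One coordinate is substituted at a time. Used twice: from bits to strings, then from strings to
-- letters.
zipWith-invariant : ∀ (E : List A) (_∙_ : A → A → A) → (∀ s → Invariant E (_∙ s)) →
                    ∀ {m} (s : Vec A m) → Invariant (vecs E m) (λ v → zipWith _∙_ v s)
zipWith-invariant E _∙_ inv []      f = refl
zipWith-invariant E _∙_ inv {suc m} (s ∷ ss) f = begin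
  ∑ (vecs E (suc m)) (λ v → f (zipWith _∙_ v (s ∷ ss)))
    ≡⟨ ∑-cartesian _∷_ E (vecs E m) _ ⟩
  ∑ E (λ z → ∑ (vecs E m) (λ v → f ((z ∙ s) ∷ zipWith _∙_ v ss)))
    ≡⟨ ∑-cong E (λ z → zipWith-invariant E _∙_ inv ss (λ v → f ((z ∙ s) ∷ v))) ⟩
  ∑ E (λ z → ∑ (vecs E m) (λ v → f ((z ∙ s) ∷ v)))
    ≡⟨ inv s (λ z → ∑ (vecs E m) (λ v → f (z ∷ v))) ⟩
  ∑ E (λ z → ∑ (vecs E m) (λ v → f (z ∷ v)))
    ≡⟨ sym (∑-cartesian _∷_ E (vecs E m) f) ⟩
  ∑ (vecs E (suc m)) f ∎
  where open ≡-Reasoning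

-- Planted pairs meet every large rectangle

-- Either every coordinate is true and the product is 1, or a false one contributes 1 to the sum.
-- Summed over words, this separates the words with heavy letters only from a union bound over the
-- places.
1≤∏ι+∑ι-not : ∀ (t : Fin m → Bool) → 1 ≤ ∏ (ι ∘ t) + ∑ (allFin m) (ι ∘ not ∘ t)
1≤∏ι+∑ι-not {m} t with any? (λ a → t a ≟B false)
... | yes (a , ta≡false) = begin
  1                                          ≡⟨ cong (ι ∘ not) ta≡false ⟨
  ι (not (t a))                              ≤⟨ ∈⇒≤∑ (∈-allFin a) (ι ∘ not ∘ t) ⟩
  ∑ (allFin m) (ι ∘ not ∘ t)                 ≤⟨ m≤n+m _ _ ⟩
  ∏ (ι ∘ t) + ∑ (allFin m) (ι ∘ not ∘ t)     ∎
  where open ≤-Reasoning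
... | no ¬false = begin
  1                                          ≡⟨ trans (∏-const m 1) (^-zeroˡ m) ⟨
  ∏ {m} (λ _ → 1)                            ≤⟨ ∏-mono (λ a → 1≤ι (t a) (λ e → ¬false (a , e))) ⟩
  ∏ (ι ∘ t)                                  ≤⟨ m≤m+n _ _ ⟩
  ∏ (ι ∘ t) + ∑ (allFin m) (ι ∘ not ∘ t)     ∎
  where
  open ≤-Reasoning
  1≤ι : ∀ b → b ≢ false → 1 ≤ ι b
  1≤ι true  _ = ≤-refl
  1≤ι false f = contradiction refl f

-- The AM-GM inequality without subtraction: with q = x + d the sum condition gives y ≤ x + 2d, and
-- x (x + 2d) + d² = (x + d)².
smaller-factor : ∀ x y q → x ≤ q → x + y ≤ q + q → x * y ≤ q * q
smaller-factor x y q x≤q x+y≤2q with m≤n⇒∃[o]m+o≡n x≤q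
... | d , refl = begin
  x * y                        ≤⟨ *-monoʳ-≤ x (+-cancelˡ-≤ x _ _ (≤-trans x+y≤2q (≤-reflexive (shift x d)))) ⟩
  x * (x + (d + d))            ≤⟨ m≤m+n _ (d * d) ⟩
  x * (x + (d + d)) + d * d    ≡⟨ square x d ⟨
  (x + d) * (x + d)            ∎
  where
  open ≤-Reasoning
  square : ∀ x d → (x + d) * (x + d) ≡ x * (x + (d + d)) + d * d
  square = solve-∀
  shift : ∀ x d → x + d + (x + d) ≡ x + (x + (d + d))
  shift = solve-∀

sum≤2q⇒product≤q² : ∀ x y q → x + y ≤ q + q → x * y ≤ q * q
sum≤2q⇒product≤q² x y q x+y≤2q with x ≤? q
... | yes x≤q = smaller-factor x y q x≤q x+y≤2q
... | no  x≰q = subst (_≤ q * q) (*-comm y x)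
  (smaller-factor y x q (+-cancelˡ-≤ q _ _ (≤-trans (+-monoˡ-≤ y (≰⇒≥ x≰q)) x+y≤2q))
                  (subst (_≤ q + q) (+-comm x y) x+y≤2q))

ι-not*≤ : ∀ {P : Set} (P? : Dec P) {x y} → (¬ P → x ≤ y) → ι (not (does P?)) * x ≤ y
ι-not*≤ (yes _) _   = z≤n
ι-not*≤ (no ¬p) x≤y = ≤-trans (≤-reflexive (*-identityˡ _)) (x≤y ¬p)

ι+ι≤1 : ∀ {P Q : Set} (P? : Dec P) (Q? : Dec Q) → ¬ (P × Q) → ι (does P?) + ι (does Q?) ≤ 1
ι+ι≤1 (yes p) (yes q) ¬p×q = contradiction (p , q) ¬p×q
ι+ι≤1 (yes _) (no _)  _    = ≤-refl
ι+ι≤1 (no _)  Q?      _    = ι≤1 (does Q?)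

card : List (Vec Σ m) → (Vec Σ m → Bool) → ℕ
card Ω A = ∑ Ω (ι ∘ A)

slice : DecidableEquality Σ → List (Vec Σ m) → (Vec Σ m → Bool) → Fin m → Σ → ℕ
slice _≟_ Ω A a z = ∑ Ω (λ x → ι (A x) * ι (does (lookup x a ≟ z)))

-- There are `m * length E` pairs of a place and a letter, so at this threshold all light ones
-- together account for at most half of `A`.
Heavy : DecidableEquality Σ → List Σ → (Vec Σ m → Bool) → Fin m → Σ → Set
Heavy {m = m} _≟_ E A a z =
  card (vecs E m) A ≤ 2 * (m * length E) * slice _≟_ (vecs E m) A a z

heavy? : ∀ (_≟_ : DecidableEquality Σ) E (A : Vec Σ m → Bool) a z → Dec (Heavy _≟_ E A a z)
heavy? _≟_ E A a z = _ ≤? _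

planted : DecidableEquality Σ → (Σ → Σ) → Vec Σ m → Vec Σ m → Bool
planted _≟_ π x y = does (any? (λ a → lookup y a ≟ π (lookup x a)))

-- The words of A having a light letter somewhere are at most half of A, and the others lie in
-- the product of the sets of heavy letters.
card≤∏heavy : ∀ (_≟_ : DecidableEquality Σ) (E : List Σ) → (∀ z → z ∈ E) →
              ∀ (A : Vec Σ m → Bool) → 1 ≤ m * length E →
              card (vecs E m) A ≤ 2 * ∏ (λ a → ∑ E (λ z → ι (does (heavy? _≟_ E A a z))))
card≤∏heavy {Σ = Σ} {m = m} _≟_ E ∈E A 1≤mE = +-cancelʳ-≤ |A| _ _ (begin
  |A| + |A|                      ≡⟨ double |A| ⟨
  2 * |A|                        ≤⟨ *-monoʳ-≤ 2 |A|≤heavy+light ⟩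
  2 * (allHeavy + someLight)     ≡⟨ *-distribˡ-+ 2 allHeavy someLight ⟩
  2 * allHeavy + 2 * someLight   ≤⟨ +-monoʳ-≤ (2 * allHeavy) 2light≤|A| ⟩
  2 * allHeavy + |A|             ∎)
  where
  open ≤-Reasoning
  Ω = vecs E m
  |A| = card Ω A
  h : Fin m → Σ → Bool
  h a z = does (heavy? _≟_ E A a z)
  allHeavy = ∏ (λ a → ∑ E (ι ∘ h a))
  r : Fin m → ℕ
  r a = ∑ Ω (λ x → ι (A x) * ι (not (h a (lookup x a))))
  someLight = ∑ (allFin m) r
  double : ∀ n → 2 * n ≡ n + n
  double = solve-∀

  pointwise : ∀ x → ι (A x) ≤ ∏ (λ a → ι (h a (lookup x a)))
                              + ∑ (allFin m) (λ a → ι (A x) * ι (not (h a (lookup x a))))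
  pointwise x with A x
  ... | false = z≤n
  ... | true  = ≤-trans (1≤∏ι+∑ι-not (λ a → h a (lookup x a)))
    (+-monoʳ-≤ (∏ (λ a → ι (h a (lookup x a))))
       (≤-reflexive (∑-cong (allFin m) (λ a → sym (*-identityˡ _)))))

  |A|≤heavy+light : |A| ≤ allHeavy + someLight
  |A|≤heavy+light = begin
    |A| ≤⟨ ∑-mono Ω pointwise ⟩
    ∑ Ω (λ x → ∏ (λ a → ι (h a (lookup x a))) + ∑ (allFin m) (λ a → ι (A x) * ι (not (h a (lookup x a)))))
      ≡⟨ ∑-+ Ω _ _ ⟩
    ∑ Ω (λ x → ∏ (λ a → ι (h a (lookup x a)))) + ∑ Ω (λ x → ∑ (allFin m) (λ a → ι (A x) * ι (not (h a (lookup x a)))))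
      ≡⟨ cong₂ _+_ (∑-vecs-∏ E m (λ a → ι ∘ h a)) (∑-swap Ω (allFin m) _) ⟩
    allHeavy + someLight ∎

  light≤ : ∀ a z → ι (not (h a z)) * (2 * (m * length E) * slice _≟_ Ω A a z) ≤ |A|
  light≤ a z = ι-not*≤ (heavy? _≟_ E A a z) ≰⇒≥

  -- The summand at z = `lookup x a` already equals the left side. This turns a letter depending on
  -- x into a summation variable, so that slices appear after exchanging the sums.
  locate : ∀ a x → ι (A x) * ι (not (h a (lookup x a)))
                   ≤ ∑ E (λ z → ι (not (h a z)) * (ι (A x) * ι (does (lookup x a ≟ z))))
  locate a x = begin
    ι (A x) * ι (not (h a (lookup x a)))
      ≡⟨ *-comm (ι (A x)) _ ⟩
    ι (not (h a (lookup x a))) * ι (A x)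
      ≡⟨ cong (ι (not (h a (lookup x a))) *_) (*-identityʳ (ι (A x))) ⟨
    ι (not (h a (lookup x a))) * (ι (A x) * 1)
      ≡⟨ cong (λ b → ι (not (h a (lookup x a))) * (ι (A x) * ι b)) (dec-true (lookup x a ≟ lookup x a) refl) ⟨
    ι (not (h a (lookup x a))) * (ι (A x) * ι (does (lookup x a ≟ lookup x a)))
      ≤⟨ ∈⇒≤∑ (∈E (lookup x a)) (λ z → ι (not (h a z)) * (ι (A x) * ι (does (lookup x a ≟ z)))) ⟩
    ∑ E (λ z → ι (not (h a z)) * (ι (A x) * ι (does (lookup x a ≟ z)))) ∎

  r≤ : ∀ a → 2 * (m * length E) * r a ≤ length E * |A|
  r≤ a = begin
    2 * (m * length E) * r a
      ≤⟨ *-monoʳ-≤ (2 * (m * length E)) (∑-mono Ω (locate a)) ⟩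
    2 * (m * length E) * ∑ Ω (λ x → ∑ E (λ z → ι (not (h a z)) * (ι (A x) * ι (does (lookup x a ≟ z)))))
      ≡⟨ cong (2 * (m * length E) *_) (trans (∑-swap Ω E _) (∑-cong E (λ z → ∑-*ˡ Ω (ι (not (h a z))) _))) ⟩
    2 * (m * length E) * ∑ E (λ z → ι (not (h a z)) * slice _≟_ Ω A a z)
      ≡⟨ ∑-*ˡ E (2 * (m * length E)) _ ⟨
    ∑ E (λ z → 2 * (m * length E) * (ι (not (h a z)) * slice _≟_ Ω A a z))
      ≡⟨ ∑-cong E (λ z → exchange (2 * (m * length E)) (ι (not (h a z))) (slice _≟_ Ω A a z)) ⟩
    ∑ E (λ z → ι (not (h a z)) * (2 * (m * length E) * slice _≟_ Ω A a z))
      ≤⟨ ∑-mono E (light≤ a) ⟩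
    ∑ E (λ _ → |A|)
      ≡⟨ ∑-const E |A| ⟩
    length E * |A| ∎
    where
    exchange : ∀ x y z → x * (y * z) ≡ y * (x * z)
    exchange = solve-∀

  2light≤|A| : 2 * someLight ≤ |A|
  2light≤|A| = *-cancelˡ-≤ (m * length E) {{>-nonZero 1≤mE}} (begin
    m * length E * (2 * someLight)                          ≡⟨ regroup (m * length E) someLight ⟩
    2 * (m * length E) * someLight                          ≡⟨ ∑-*ˡ (allFin m) (2 * (m * length E)) r ⟨
    ∑ (allFin m) (λ a → 2 * (m * length E) * r a)   ≤⟨ ∑-mono (allFin m) r≤ ⟩
    ∑ (allFin m) (λ _ → length E * |A|)             ≡⟨ ∑-const (allFin m) _ ⟩
    length (allFin m) * (length E * |A|)            ≡⟨ cong (_* (length E * |A|)) (length-tabulate {n = m} (λ a → a)) ⟩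
    m * (length E * |A|)                            ≡⟨ *-assoc m (length E) |A| ⟨
    m * length E * |A|                              ∎)
    where
    regroup : ∀ x y → x * (2 * y) ≡ 2 * x * y
    regroup = solve-∀

-- Either some letter z is heavy in A while π z is heavy in B at the same place, which yields many
-- planted pairs, or at every place the heavy letters of A and B number at most |Σ| together.
corruption : ∀ (_≟_ : DecidableEquality Σ) (E : List Σ) → (∀ z → z ∈ E) →
             ∀ q → length E ≡ q + q → ∀ (π : Σ → Σ) → Invariant E π →
             1 ≤ m * length E → ∀ (A B : Vec Σ m → Bool) →
             card (vecs E m) A * card (vecs E m) B ≤
               2 * (m * length E) * (2 * (m * length E)) *
                 ∑ (vecs E m) (λ x → ∑ (vecs E m) (λ y → ι (planted _≟_ π x y) * (ι (A x) * ι (B y))))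
               + 4 * (q * q) ^ m
corruption {Σ = Σ} {m = m} _≟_ E ∈E q |E|≡2q π inv 1≤mE A B
  with any? (λ a → Any.any? (λ z → heavy? _≟_ E A a z ×-dec heavy? _≟_ E B a (π z)) E)
... | yes (a , ∃z) = found (Any.satisfied ∃z)
  where
  open ≤-Reasoning
  Ω = vecs E m
  c = 2 * (m * length E)
  regroup : ∀ c x y → c * x * (c * y) ≡ c * c * (x * y)
  regroup = solve-∀
  both : Σ → Vec Σ m → Vec Σ m → ℕ
  both z x y = ι (A x) * ι (does (lookup x a ≟ z)) * (ι (B y) * ι (does (lookup y a ≟ π z)))
  hit : ∀ z x y → both z x y ≤ ι (planted _≟_ π x y) * (ι (A x) * ι (B y))
  hit z x y with lookup x a ≟ z | lookup y a ≟ π z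
  ... | no _ | d = ≤-trans (≤-reflexive (cong (_* (ι (B y) * ι (does d))) (*-zeroʳ (ι (A x))))) z≤n
  ... | yes _ | no _ = ≤-trans (≤-reflexive (trans (cong (ι (A x) * 1 *_) (*-zeroʳ (ι (B y)))) (*-zeroʳ (ι (A x) * 1)))) z≤n
  ... | yes xa≡z | yes ya≡πz = ≤-reflexive (trans (rearrange (ι (A x)) (ι (B y)))
    (cong (λ b → ι b * (ι (A x) * ι (B y)))
      (sym (dec-true (any? _) (a , trans ya≡πz (cong π (sym xa≡z)))))))
    where
    rearrange : ∀ p q → p * 1 * (q * 1) ≡ 1 * (p * q)
    rearrange = solve-∀
  found : ∃ (λ z → Heavy _≟_ E A a z × Heavy _≟_ E B a (π z)) → _
  found (z , heavyA , heavyB) = begin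
    card Ω A * card Ω B
      ≤⟨ *-mono-≤ heavyA heavyB ⟩
    c * slice _≟_ Ω A a z * (c * slice _≟_ Ω B a (π z))
      ≡⟨ regroup c (slice _≟_ Ω A a z) (slice _≟_ Ω B a (π z)) ⟩
    c * c * (slice _≟_ Ω A a z * slice _≟_ Ω B a (π z))
      ≡⟨ cong (c * c *_) (∑-* Ω Ω _ _) ⟨
    c * c * ∑ Ω (λ x → ∑ Ω (both z x))
      ≤⟨ *-monoʳ-≤ (c * c) (∑-mono Ω (λ x → ∑-mono Ω (hit z x))) ⟩
    c * c * ∑ Ω (λ x → ∑ Ω (λ y → ι (planted _≟_ π x y) * (ι (A x) * ι (B y))))
      ≤⟨ m≤m+n _ _ ⟩
    c * c * ∑ Ω (λ x → ∑ Ω (λ y → ι (planted _≟_ π x y) * (ι (A x) * ι (B y)))) + 4 * (q * q) ^ m ∎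
... | no none = begin
  card Ω A * card Ω B
    ≤⟨ *-mono-≤ (card≤∏heavy _≟_ E ∈E A 1≤mE) (card≤∏heavy _≟_ E ∈E B 1≤mE) ⟩
  2 * ∏ (λ a → |h| A a) * (2 * ∏ (λ a → |h| B a))
    ≡⟨ regroup (∏ (λ a → |h| A a)) (∏ (λ a → |h| B a)) ⟩
  4 * (∏ (λ a → |h| A a) * ∏ (λ a → |h| B a))
    ≡⟨ cong (4 *_) (∏-* (λ a → |h| A a) (λ a → |h| B a)) ⟨
  4 * ∏ (λ a → |h| A a * |h| B a)
    ≤⟨ *-monoʳ-≤ 4 (∏-mono (λ a → sum≤2q⇒product≤q² (|h| A a) (|h| B a) q (few a))) ⟩
  4 * ∏ {m} (λ _ → q * q)
    ≡⟨ cong (4 *_) (∏-const m (q * q)) ⟩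
  4 * (q * q) ^ m
    ≤⟨ m≤n+m _ (c * c * ∑ Ω (λ x → ∑ Ω (λ y → ι (planted _≟_ π x y) * (ι (A x) * ι (B y))))) ⟩
  c * c * ∑ Ω (λ x → ∑ Ω (λ y → ι (planted _≟_ π x y) * (ι (A x) * ι (B y)))) + 4 * (q * q) ^ m ∎
  where
  open ≤-Reasoning
  Ω = vecs E m
  c = 2 * (m * length E)
  h : (Vec Σ m → Bool) → Fin m → Σ → Bool
  h A a z = does (heavy? _≟_ E A a z)
  |h| : (Vec Σ m → Bool) → Fin m → ℕ
  |h| A a = ∑ E (ι ∘ h A a)
  regroup : ∀ x y → 2 * x * (2 * y) ≡ 4 * (x * y)
  regroup = solve-∀
  disjoint : ∀ a z → ι (h A a z) + ι (h B a (π z)) ≤ 1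
  disjoint a z = ι+ι≤1 (heavy? _≟_ E A a z) (heavy? _≟_ E B a (π z))
    (λ (hA , hB) → none (a , lose (∈E z) (hA , hB)))
  -- By invariance the heavy letters of `B` are as many as the z with `π z` heavy in `B`, and none
  -- of these z is heavy in `A`.
  few : ∀ a → |h| A a + |h| B a ≤ q + q
  few a = begin
    |h| A a + |h| B a                              ≡⟨ cong (|h| A a +_) (inv (ι ∘ h B a)) ⟨
    |h| A a + ∑ E (λ z → ι (h B a (π z)))          ≡⟨ ∑-+ E _ _ ⟨
    ∑ E (λ z → ι (h A a z) + ι (h B a (π z)))      ≤⟨ ∑-mono E (disjoint a) ⟩
    ∑ E (λ _ → 1)                                  ≡⟨ length-∑ E ⟨
    length E                                       ≡⟨ |E|≡2q ⟩
    q + q                                          ∎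

-- Sums of rectangles

Rect : Set → Set → Set
Rect A B = (A → Bool) × (B → Bool)

⟦_⟧ : Rect A B → A → B → ℕ
⟦ p , q ⟧ x y = ι (p x) * ι (q y)

-- The rectangles may overlap and repeat, and `s` bounds their number with multiplicity. This makes
-- the notion closed under sums and products, and it is all that the corruption bound has to know
-- about a protocol.
record RectSum (A B : Set) (s : ℕ) (h : A → B → ℕ) : Set where
  no-eta-equality
  pattern
  constructor rectSum
  field
    rects  : List (Rect A B)
    size   : length rects ≤ s
    expand : ∀ x y → h x y ≡ ∑ rects (λ r → ⟦ r ⟧ x y)

RectSum-cong : (∀ x y → φ x y ≡ ψ x y) → RectSum A B s φ → RectSum A B s ψ
RectSum-cong φ≡ψ (rectSum rs l e) = rectSum rs l (λ x y → trans (sym (φ≡ψ x y)) (e x y))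

RectSum-weaken : s ≤ s′ → RectSum A B s φ → RectSum A B s′ φ
RectSum-weaken s≤s′ (rectSum rs l e) = rectSum rs (≤-trans l s≤s′) e

RectSum-0 : RectSum A B s (λ _ _ → 0)
RectSum-0 = rectSum [] z≤n (λ _ _ → refl)

RectSum-1 : RectSum A B 1 (λ _ _ → 1)
RectSum-1 = rectSum (((λ _ → true) , (λ _ → true)) ∷ []) ≤-refl (λ _ _ → refl)

RectSum-⟦⟧ : (r : Rect A B) → RectSum A B 1 ⟦ r ⟧
RectSum-⟦⟧ r = rectSum (r ∷ []) ≤-refl (λ x y → sym (+-identityʳ _))

RectSum-+ : RectSum A B s φ → RectSum A B s′ ψ → RectSum A B (s + s′) (λ x y → φ x y + ψ x y)
RectSum-+ (rectSum rs l e) (rectSum rs′ l′ e′) = rectSum (rs ++ rs′)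
  (≤-trans (≤-reflexive (length-++ rs)) (+-mono-≤ l l′))
  (λ x y → trans (cong₂ _+_ (e x y) (e′ x y)) (sym (∑-++ rs rs′ _)))

_∩_ : Rect A B → Rect A B → Rect A B
(p , q) ∩ (p′ , q′) = (λ x → p x ∧ p′ x) , (λ y → q y ∧ q′ y)

⟦∩⟧ : ∀ (r r′ : Rect A B) x y → ⟦ r ∩ r′ ⟧ x y ≡ ⟦ r ⟧ x y * ⟦ r′ ⟧ x y
⟦∩⟧ (p , q) (p′ , q′) x y rewrite ι-∧ (p x) (p′ x) | ι-∧ (q y) (q′ y) =
  interchange (ι (p x)) (ι (p′ x)) (ι (q y)) (ι (q′ y))
  where
  interchange : ∀ a b c d → a * b * (c * d) ≡ a * c * (b * d)
  interchange = solve-∀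

-- Multiplying out the two sums leaves products of two rectangles, which are again rectangles.
RectSum-* : RectSum A B s φ → RectSum A B s′ ψ → RectSum A B (s * s′) (λ x y → φ x y * ψ x y)
RectSum-* (rectSum rs l e) (rectSum rs′ l′ e′) = rectSum (cartesianProductWith _∩_ rs rs′)
  (≤-trans (≤-reflexive (length-cartesian _∩_ rs rs′)) (*-mono-≤ l l′))
  (λ x y → trans (cong₂ _*_ (e x y) (e′ x y)) (sym (trans (∑-cartesian _∩_ rs rs′ _)
    (trans (∑-cong rs (λ r → ∑-cong rs′ (λ r′ → ⟦∩⟧ r r′ x y))) (∑-* rs rs′ _ _)))))

RectSum-^ : ∀ k → RectSum A B s φ → RectSum A B (s ^ k) (λ x y → φ x y ^ k)
RectSum-^ zero    R = RectSum-1
RectSum-^ (suc k) R = RectSum-* R (RectSum-^ k R)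

RectSum-∑ : ∀ {I : Set} (xs : List I) {f : I → A → B → ℕ} → (∀ i → RectSum A B s (f i)) →
            RectSum A B (length xs * s) (λ x y → ∑ xs (λ i → f i x y))
RectSum-∑ []       R = RectSum-0
RectSum-∑ (i ∷ xs) R = RectSum-+ (R i) (RectSum-∑ xs R)

-- `corruption` is summed over the rectangles of `h`. Only the error term feels how many there are.
corruption-∑ : ∀ (_≟_ : DecidableEquality Σ) (E : List Σ) → (∀ z → z ∈ E) →
               ∀ q → length E ≡ q + q → ∀ (π : Σ → Σ) → Invariant E π →
               1 ≤ m * length E → ∀ {h} → RectSum (Vec Σ m) (Vec Σ m) s h →
               ∑ (vecs E m) (λ x → ∑ (vecs E m) (h x)) ≤
                 2 * (m * length E) * (2 * (m * length E)) *
                   ∑ (vecs E m) (λ x → ∑ (vecs E m) (λ y → ι (planted _≟_ π x y) * h x y))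
                 + s * (4 * (q * q) ^ m)
corruption-∑ {Σ} {m} {s} _≟_ E ∈E q |E|≡2q π inv 1≤mE {h} (rectSum rs l e) = begin
  ∑ Ω (λ x → ∑ Ω (h x))
    ≡⟨ ∑-cong Ω (λ x → ∑-cong Ω (λ y → *-identityˡ (h x y))) ⟨
  ∑ Ω (λ x → ∑ Ω (λ y → 1 * h x y))
    ≡⟨ ∑-out (λ _ _ → 1) ⟨
  ∑ rs (λ r → ∑ Ω (λ x → ∑ Ω (λ y → 1 * ⟦ r ⟧ x y)))
    ≡⟨ ∑-cong rs (λ r → trans (∑-cong Ω (λ x → ∑-cong Ω (λ y → *-identityˡ (⟦ r ⟧ x y)))) (∑-* Ω Ω _ _)) ⟩
  ∑ rs (λ r → card Ω (proj₁ r) * card Ω (proj₂ r))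
    ≤⟨ ∑-mono rs (λ r → corruption _≟_ E ∈E q |E|≡2q π inv 1≤mE (proj₁ r) (proj₂ r)) ⟩
  ∑ rs (λ r → c² * ∑ Ω (λ x → ∑ Ω (λ y → w x y * ⟦ r ⟧ x y)) + 4 * (q * q) ^ m)
    ≡⟨ ∑-+ rs _ _ ⟩
  ∑ rs (λ r → c² * ∑ Ω (λ x → ∑ Ω (λ y → w x y * ⟦ r ⟧ x y))) + ∑ rs (λ _ → 4 * (q * q) ^ m)
    ≤⟨ +-mono-≤ (≤-reflexive (∑-*ˡ rs c² _))
         (≤-trans (≤-reflexive (∑-const rs _)) (*-monoˡ-≤ _ l)) ⟩
  c² * ∑ rs (λ r → ∑ Ω (λ x → ∑ Ω (λ y → w x y * ⟦ r ⟧ x y))) + s * (4 * (q * q) ^ m)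
    ≡⟨ cong (λ t → c² * t + s * (4 * (q * q) ^ m)) (∑-out w) ⟩
  c² * ∑ Ω (λ x → ∑ Ω (λ y → w x y * h x y)) + s * (4 * (q * q) ^ m) ∎
  where
  open ≤-Reasoning
  Ω = vecs E m
  c² = 2 * (m * length E) * (2 * (m * length E))
  w : Vec Σ m → Vec Σ m → ℕ
  w x y = ι (planted _≟_ π x y)
  -- Needed with weight 1 for the left side and with the planted indicator for the right side.
  ∑-out : ∀ (w : Vec Σ m → Vec Σ m → ℕ) →
          ∑ rs (λ r → ∑ Ω (λ x → ∑ Ω (λ y → w x y * ⟦ r ⟧ x y))) ≡
          ∑ Ω (λ x → ∑ Ω (λ y → w x y * h x y))
  ∑-out w = trans (∑-swap rs Ω _) (∑-cong Ω (λ x → trans (∑-swap rs Ω _)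
    (∑-cong Ω (λ y → trans (∑-*ˡ rs (w x y) _) (cong (w x y *_) (sym (e x y)))))))

-- Repeated runs

-- The labelled rectangles of all (seed, leaf) pairs of a randomized protocol with `seeds` seeds.
record Family (A B O : Set) (S : ℕ) : Set where
  no-eta-equality
  field
    rects   : List (O × Rect A B)
    seeds   : ℕ
    cover   : ∀ x y → ∑ rects (λ (_ , r) → ⟦ r ⟧ x y) ≡ seeds
    seeds>0 : 0 < seeds
    size    : length rects ≤ S
open Family public

Family-comap : (A′ → A) → (B′ → B) → Family A B O S → Family A′ B′ O S
Family-comap f g F .rects = map (λ (o , p , q) → o , p ∘ f , q ∘ g) (rects F)
Family-comap f g F .seeds = seeds F
Family-comap f g F .cover x y = trans (∑-map _ (rects F) _) (cover F (f x) (g y))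
Family-comap f g F .seeds>0 = seeds>0 F
Family-comap f g F .size = ≤-trans (≤-reflexive (length-map _ (rects F))) (size F)

Family-weaken : ∀ {S′} → S ≤ S′ → Family A B O S → Family A B O S′
Family-weaken S≤S′ F .rects   = rects F
Family-weaken S≤S′ F .seeds   = seeds F
Family-weaken S≤S′ F .cover   = cover F
Family-weaken S≤S′ F .seeds>0 = seeds>0 F
Family-weaken S≤S′ F .size    = ≤-trans (size F) S≤S′

-- The acceptance probability is `passes / runs`, kept as two integers. Acceptance rather than
-- rejection is a sum of rectangles, because the corruption bound is applied to its powers.
record Test (A B : Set) (S : ℕ) : Set where
  no-eta-equality
  field
    passes   : A → B → ℕ
    runs     : ℕ
    passes≤  : ∀ x y → passes x y ≤ runs
    runs>0   : 0 < runs
    rectSums : RectSum A B S passes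
open Test public

module Counting (_≟_ : DecidableEquality O) where

  same : O → O → ℕ
  same o s = ι (does (o ≟ s))

  count : Family A B O S → O → A → B → ℕ
  count F s x y = ∑ (rects F) (λ (o , r) → same o s * ⟦ r ⟧ x y)

  others : Family A B O S → O → A → B → ℕ
  others F s x y = ∑ (rects F) (λ (o , r) → ι (not (does (o ≟ s))) * ⟦ r ⟧ x y)

  count+others : ∀ (F : Family A B O S) s x y → count F s x y + others F s x y ≡ seeds F
  count+others F s x y = begin
    count F s x y + others F s x y
      ≡⟨ ∑-+ (rects F) _ _ ⟨
    ∑ (rects F) (λ (o , r) → same o s * ⟦ r ⟧ x y + ι (not (does (o ≟ s))) * ⟦ r ⟧ x y)
      ≡⟨ ∑-cong (rects F) (λ (o , r) → trans (sym (*-distribʳ-+ (⟦ r ⟧ x y) (same o s) _))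
           (trans (cong (_* ⟦ r ⟧ x y) (ι+ι-not (does (o ≟ s)))) (*-identityˡ _))) ⟩
    ∑ (rects F) (λ (_ , r) → ⟦ r ⟧ x y)
      ≡⟨ cover F x y ⟩
    seeds F ∎
    where open ≡-Reasoning

  count≤seeds : ∀ (F : Family A B O S) s x y → count F s x y ≤ seeds F
  count≤seeds F s x y = ≤-trans (m≤m+n _ _) (≤-reflexive (count+others F s x y))

  count-comap : ∀ (f : A′ → A) (g : B′ → B) (F : Family A B O S) s x y →
                count (Family-comap f g F) s x y ≡ count F s (f x) (g y)
  count-comap f g F s x y = ∑-map _ (rects F) _

  -- Two different outputs above a threshold a / b ≥ 1/2 would have total probability above 1. When
  -- no output exceeds it, `default` serves as s₀.
  majority : ∀ (F : Family A B O S) a b x y → b ≤ 2 * a → O → {os : List O} → (∀ o → o ∈ os) →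
             ∃ λ s₀ → ∀ s → s ≢ s₀ → count F s x y * b ≤ a * seeds F
  majority F a b x y b≤2a default {os} ∈os
    with Any.any? (λ s → a * seeds F <? count F s x y * b) os
  ... | no none = default , λ s _ → ≮⇒≥ (λ big → none (lose (∈os s) big))
  ... | yes some = proj₁ (Any.satisfied some) , rare _ (proj₂ (Any.satisfied some))
    where
    open ≤-Reasoning
    Z = seeds F
    rearrange : ∀ z a → z * (2 * a) ≡ a * z + a * z
    rearrange = solve-∀
    rare : ∀ s₀ → a * Z < count F s₀ x y * b → ∀ s → s ≢ s₀ → count F s x y * b ≤ a * Z
    rare s₀ big s s≢s₀ = +-cancelˡ-≤ (a * Z) _ _ (begin
      a * Z + count F s x y * b                    ≤⟨ +-monoˡ-≤ _ (<⇒≤ big) ⟩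
      count F s₀ x y * b + count F s x y * b       ≡⟨ *-distribʳ-+ b (count F s₀ x y) _ ⟨
      (count F s₀ x y + count F s x y) * b         ≤⟨ *-monoˡ-≤ b (+-monoʳ-≤ (count F s₀ x y) s≤others) ⟩
      (count F s₀ x y + others F s₀ x y) * b       ≡⟨ cong (_* b) (count+others F s₀ x y) ⟩
      Z * b                                        ≤⟨ *-monoʳ-≤ Z b≤2a ⟩
      Z * (2 * a)                                  ≡⟨ rearrange Z a ⟩
      a * Z + a * Z                                ∎)
      where
      different : ∀ o → same o s ≤ ι (not (does (o ≟ s₀)))
      different o with o ≟ s
      ... | no _     = z≤n
      ... | yes refl with o ≟ s₀
      ...   | yes o≡s₀ = contradiction o≡s₀ s≢s₀
      ...   | no _     = ≤-refl
      s≤others : count F s x y ≤ others F s₀ x y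
      s≤others = ∑-mono (rects F) (λ (o , r) → *-monoˡ-≤ (⟦ r ⟧ x y) (different o))

  -- The number of k-tuples of runs that do not all output s.
  notAll : Family A B O S → O → ℕ → A → B → ℕ
  notAll F s zero    x y = 0
  notAll F s (suc k) x y = others F s x y * seeds F ^ k + count F s x y * notAll F s k x y

  -- `notAll` splits on the first run instead of subtracting powers, since a difference would not be
  -- visibly a sum of rectangles. This identity shows that nothing is lost.
  notAll+all : ∀ (F : Family A B O S) s k x y → notAll F s k x y + count F s x y ^ k ≡ seeds F ^ k
  notAll+all F s zero    x y = refl
  notAll+all F s (suc k) x y = begin
    e * Z ^ k + c * n + c * c ^ k   ≡⟨ regroup e (Z ^ k) c n (c ^ k) ⟩
    e * Z ^ k + c * (n + c ^ k)     ≡⟨ cong (λ t → e * Z ^ k + c * t) (notAll+all F s k x y) ⟩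
    e * Z ^ k + c * Z ^ k           ≡⟨ *-distribʳ-+ (Z ^ k) e c ⟨
    (e + c) * Z ^ k                 ≡⟨ cong (_* Z ^ k) (trans (+-comm e c) (count+others F s x y)) ⟩
    Z * Z ^ k                       ∎
    where
    open ≡-Reasoning
    Z = seeds F
    c = count F s x y
    e = others F s x y
    n = notAll F s k x y
    regroup : ∀ e z c n d → e * z + c * n + c * d ≡ e * z + c * (n + d)
    regroup = solve-∀

  -- Of k + 1 runs: those not all giving one and the same output in D.
  good bad : Family A B O S → (O → Bool) → ℕ → A → B → ℕ
  good F D k x y = ∑ (rects F) (λ (o , r) → ⟦ r ⟧ x y * (if D o then notAll F o k x y else seeds F ^ k))
  bad  F D k x y = ∑ (rects F) (λ (o , r) → ⟦ r ⟧ x y * (ι (D o) * count F o x y ^ k))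

  good+bad : ∀ (F : Family A B O S) D k x y → good F D k x y + bad F D k x y ≡ seeds F * seeds F ^ k
  good+bad F D k x y = begin
    good F D k x y + bad F D k x y
      ≡⟨ ∑-+ (rects F) _ _ ⟨
    ∑ (rects F) (λ (o , r) → ⟦ r ⟧ x y * (if D o then notAll F o k x y else Z ^ k)
                             + ⟦ r ⟧ x y * (ι (D o) * count F o x y ^ k))
      ≡⟨ ∑-cong (rects F) (λ (o , r) → trans (sym (*-distribˡ-+ (⟦ r ⟧ x y) _ _)) (cong (⟦ r ⟧ x y *_) (split o))) ⟩
    ∑ (rects F) (λ (_ , r) → ⟦ r ⟧ x y * Z ^ k)
      ≡⟨ ∑-*ʳ (rects F) (Z ^ k) _ ⟩
    ∑ (rects F) (λ (_ , r) → ⟦ r ⟧ x y) * Z ^ k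
      ≡⟨ cong (_* Z ^ k) (cover F x y) ⟩
    Z * Z ^ k ∎
    where
    open ≡-Reasoning
    Z = seeds F
    split : ∀ o → (if D o then notAll F o k x y else Z ^ k) + ι (D o) * count F o x y ^ k ≡ Z ^ k
    split o with D o
    ... | true  = trans (cong (notAll F o k x y +_) (*-identityˡ _)) (notAll+all F o k x y)
    ... | false = +-identityʳ _

  RectSum-label : ∀ (F : Family A B O S) (w : O → ℕ) → (∀ o → w o ≤ 1) →
                  RectSum A B S (λ x y → ∑ (rects F) (λ (o , r) → w o * ⟦ r ⟧ x y))
  RectSum-label F w w≤1 = RectSum-weaken
    (≤-trans (≤-reflexive (*-identityʳ _)) (size F))
    (RectSum-∑ (rects F) (λ (o , r) → scale (w o) (w≤1 o) r))
    where
    scale : ∀ n → n ≤ 1 → (r : Rect _ _) → RectSum _ _ 1 (λ x y → n * ⟦ r ⟧ x y)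
    scale zero          _ r = RectSum-0
    scale (suc zero)    _ r = RectSum-cong (λ x y → sym (*-identityˡ _)) (RectSum-⟦⟧ r)
    scale (suc (suc _)) (s≤s ()) r

  -- The cover itself decomposes the constant, so a run whose outcome does not matter costs only a
  -- factor `S`.
  RectSum-seeds : ∀ (F : Family A B O S) → RectSum A B S (λ _ _ → seeds F)
  RectSum-seeds F = RectSum-cong
    (λ x y → trans (∑-cong (rects F) (λ (_ , r) → *-identityˡ (⟦ r ⟧ x y))) (cover F x y))
    (RectSum-label F (λ _ → 1) (λ _ → ≤-refl))

  -- The recursion adds S * S ^ k rectangles to S times the previous number; doubling the base
  -- absorbs both summands.
  RectSum-notAll : ∀ (F : Family A B O S) s k → RectSum A B ((S + S) ^ k) (notAll F s k)
  RectSum-notAll F s zero = RectSum-0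
  RectSum-notAll {S = S} F s (suc k) = RectSum-weaken
    (≤-trans (+-monoˡ-≤ _ (*-monoʳ-≤ S (^-monoˡ-≤ k (m≤m+n S S))))
             (≤-reflexive (sym (*-distribʳ-+ ((S + S) ^ k) S S))))
    (RectSum-+ (RectSum-* (RectSum-label F (λ o → ι (not (does (o ≟ s)))) (λ o → ι≤1 _))
                          (RectSum-^ k (RectSum-seeds F)))
               (RectSum-* (RectSum-label F (λ o → same o s) (λ o → ι≤1 _))
                          (RectSum-notAll F s k)))

  RectSum-good : ∀ (F : Family A B O S) D k → RectSum A B ((S + S) ^ suc k) (good F D k)
  RectSum-good {A = A} {B = B} {S = S} F D k = RectSum-weaken
    (*-monoˡ-≤ ((S + S) ^ k) (≤-trans (size F) (m≤m+n S S)))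
    (RectSum-∑ (rects F) (λ (o , r) → RectSum-weaken (≤-reflexive (*-identityˡ _))
      (RectSum-* (RectSum-⟦⟧ r) (branch o))))
    where
    branch : ∀ o → RectSum A B ((S + S) ^ k) (λ x y → if D o then notAll F o k x y else seeds F ^ k)
    branch o with D o
    ... | true  = RectSum-notAll F o k
    ... | false = RectSum-weaken (^-monoˡ-≤ k (m≤m+n S S)) (RectSum-^ k (RectSum-seeds F))

  test : Family A B O S → (O → Bool) → ∀ k → Test A B ((S + S) ^ suc k)
  test F D k .passes      = good F D k
  test F D k .runs        = seeds F ^ suc k
  test F D k .passes≤ x y = ≤-trans (m≤m+n _ _) (≤-reflexive (good+bad F D k x y))
  test F D k .runs>0      = m^n>0 (seeds F) {{>-nonZero (seeds>0 F)}} (suc k)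
  test F D k .rectSums    = RectSum-good F D k

  -- The first run fixes the string, and each of the k further runs repeats it with probability at
  -- most a / b. So rejection has probability at most (a / b)^k; denominators are cleared.
  test-low : ∀ (F : Family A B O S) D k a b x y →
             (∀ o → D o ≡ true → count F o x y * b ≤ a * seeds F) →
             runs (test F D k) * b ^ k ≤ good F D k x y * b ^ k + a ^ k * runs (test F D k)
  test-low F D k a b x y small = begin
    Z * Z ^ k * b ^ k
      ≡⟨ cong (_* b ^ k) (good+bad F D k x y) ⟨
    (good F D k x y + bad F D k x y) * b ^ k
      ≡⟨ *-distribʳ-+ (b ^ k) (good F D k x y) _ ⟩
    good F D k x y * b ^ k + bad F D k x y * b ^ k
      ≤⟨ +-monoʳ-≤ (good F D k x y * b ^ k) bad≤ ⟩
    good F D k x y * b ^ k + a ^ k * (Z * Z ^ k) ∎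
    where
    open ≤-Reasoning
    Z = seeds F
    exchange : ∀ z a w → z * (a * w) ≡ a * (z * w)
    exchange = solve-∀
    term : ∀ o → ι (D o) * count F o x y ^ k * b ^ k ≤ a ^ k * Z ^ k
    term o with D o | small o
    ... | false | _ = z≤n
    ... | true  | s = begin
      1 * count F o x y ^ k * b ^ k    ≡⟨ cong (_* b ^ k) (*-identityˡ (count F o x y ^ k)) ⟩
      count F o x y ^ k * b ^ k        ≡⟨ ^-distribʳ-* k (count F o x y) b ⟨
      (count F o x y * b) ^ k          ≤⟨ ^-monoˡ-≤ k (s refl) ⟩
      (a * Z) ^ k                      ≡⟨ ^-distribʳ-* k a Z ⟩
      a ^ k * Z ^ k                    ∎
    bad≤ : bad F D k x y * b ^ k ≤ a ^ k * (Z * Z ^ k)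
    bad≤ = begin
      bad F D k x y * b ^ k
        ≡⟨ ∑-*ʳ (rects F) (b ^ k) _ ⟨
      ∑ (rects F) (λ (o , r) → ⟦ r ⟧ x y * (ι (D o) * count F o x y ^ k) * b ^ k)
        ≤⟨ ∑-mono (rects F) (λ (o , r) → ≤-trans (≤-reflexive (*-assoc (⟦ r ⟧ x y) _ _)) (*-monoʳ-≤ (⟦ r ⟧ x y) (term o))) ⟩
      ∑ (rects F) (λ (_ , r) → ⟦ r ⟧ x y * (a ^ k * Z ^ k))
        ≡⟨ ∑-*ʳ (rects F) _ _ ⟩
      ∑ (rects F) (λ (_ , r) → ⟦ r ⟧ x y) * (a ^ k * Z ^ k)
        ≡⟨ cong (_* (a ^ k * Z ^ k)) (cover F x y) ⟩
      Z * (a ^ k * Z ^ k)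
        ≡⟨ exchange Z (a ^ k) (Z ^ k) ⟩
      a ^ k * (Z * Z ^ k) ∎

  count^≤bad : ∀ (F : Family A B O S) D k x y s → D s ≡ true → count F s x y * count F s x y ^ k ≤ bad F D k x y
  count^≤bad F D k x y s Ds = begin
    count F s x y * count F s x y ^ k
      ≡⟨ ∑-*ʳ (rects F) _ _ ⟨
    ∑ (rects F) (λ (o , r) → same o s * ⟦ r ⟧ x y * count F s x y ^ k)
      ≤⟨ ∑-mono (rects F) (λ (o , r) → term o (⟦ r ⟧ x y)) ⟩
    bad F D k x y ∎
    where
    open ≤-Reasoning
    rotate : ∀ v c → 1 * v * c ≡ v * (1 * c)
    rotate = solve-∀
    term : ∀ o v → same o s * v * count F s x y ^ k ≤ v * (ι (D o) * count F o x y ^ k)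
    term o v with o ≟ s
    ... | no _ = z≤n
    ... | yes refl rewrite Ds = ≤-reflexive (rotate v _)

  -- The bound a′ ≥ b′ / 2 turns the extra run into a factor 1/2.
  test-high : ∀ (F : Family A B O S) D k a b a′ b′ T x y → 0 < b′ → b′ ≤ 2 * a′ →
              4 * T * (a * b′) ^ k ≤ (a′ * b) ^ k →
              runs (test F D k) * b ^ k < good F D k x y * b ^ k + 2 * (T * a ^ k) * runs (test F D k) →
              ∀ s → D s ≡ true → count F s x y * b′ ≤ a′ * seeds F
  test-high F D k a b a′ b′ T x y b′>0 b′≤2a′ ratio pass s Ds = ≮⇒≥ (λ big → <⇒≱ pass (fail big))
    where
    open ≤-Reasoning
    instance _ = >-nonZero b′>0
    instance _ = m^n≢0 b′ k
    Z = seeds F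
    c = count F s x y
    move : ∀ a b c d → a * b * (c * d) ≡ a * c * (b * d)
    move = solve-∀
    fail : a′ * Z < c * b′ →
           good F D k x y * b ^ k + 2 * (T * a ^ k) * (Z * Z ^ k) ≤ Z * Z ^ k * b ^ k
    fail big = begin
      good F D k x y * b ^ k + 2 * (T * a ^ k) * (Z * Z ^ k)
        ≤⟨ +-monoʳ-≤ (good F D k x y * b ^ k) (*-cancelˡ-≤ 2 heavy) ⟩
      good F D k x y * b ^ k + c * c ^ k * b ^ k
        ≤⟨ +-monoʳ-≤ (good F D k x y * b ^ k) (*-monoˡ-≤ (b ^ k) (count^≤bad F D k x y s Ds)) ⟩
      good F D k x y * b ^ k + bad F D k x y * b ^ k
        ≡⟨ *-distribʳ-+ (b ^ k) (good F D k x y) _ ⟨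
      (good F D k x y + bad F D k x y) * b ^ k
        ≡⟨ cong (_* b ^ k) (good+bad F D k x y) ⟩
      Z * Z ^ k * b ^ k ∎
      where
      Z≤2c : Z ≤ 2 * c
      Z≤2c = *-cancelʳ-≤ Z (2 * c) b′ (begin
        Z * b′          ≤⟨ *-monoʳ-≤ Z b′≤2a′ ⟩
        Z * (2 * a′)    ≡⟨ swap Z a′ ⟩
        2 * (a′ * Z)    ≤⟨ *-monoʳ-≤ 2 (<⇒≤ big) ⟩
        2 * (c * b′)    ≡⟨ *-assoc 2 c b′ ⟨
        2 * c * b′      ∎)
        where
        swap : ∀ z a → z * (2 * a) ≡ 2 * (a * z)
        swap = solve-∀
      -- Since c / Z exceeds a′ / b′, the k further runs all give s with probability at least 4 T (a
      -- / b)^k. The first run costs at most a factor 2, so rejection has probability at least 2 T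
      -- (a / b)^k, against `pass`.
      powers : 4 * T * a ^ k * Z ^ k ≤ c ^ k * b ^ k
      powers = *-cancelʳ-≤ _ _ (b′ ^ k) (begin
        4 * T * a ^ k * Z ^ k * b′ ^ k        ≡⟨ pull (4 * T) (a ^ k) (Z ^ k) (b′ ^ k) ⟩
        4 * T * (a ^ k * b′ ^ k) * Z ^ k      ≡⟨ cong (λ t → 4 * T * t * Z ^ k) (^-distribʳ-* k a b′) ⟨
        4 * T * (a * b′) ^ k * Z ^ k          ≤⟨ *-monoˡ-≤ (Z ^ k) ratio ⟩
        (a′ * b) ^ k * Z ^ k                  ≡⟨ cong (_* Z ^ k) (^-distribʳ-* k a′ b) ⟩
        a′ ^ k * b ^ k * Z ^ k                ≡⟨ last (a′ ^ k) (b ^ k) (Z ^ k) ⟩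
        a′ ^ k * Z ^ k * b ^ k                ≡⟨ cong (_* b ^ k) (^-distribʳ-* k a′ Z) ⟨
        (a′ * Z) ^ k * b ^ k                  ≤⟨ *-monoˡ-≤ (b ^ k) (^-monoˡ-≤ k (<⇒≤ big)) ⟩
        (c * b′) ^ k * b ^ k                  ≡⟨ cong (_* b ^ k) (^-distribʳ-* k c b′) ⟩
        c ^ k * b′ ^ k * b ^ k                ≡⟨ last (c ^ k) (b′ ^ k) (b ^ k) ⟩
        c ^ k * b ^ k * b′ ^ k                ∎)
        where
        pull : ∀ p q r s → p * q * r * s ≡ p * (q * s) * r
        pull = solve-∀
        last : ∀ p q r → p * q * r ≡ p * r * q
        last = solve-∀
      heavy : 2 * (2 * (T * a ^ k) * (Z * Z ^ k)) ≤ 2 * (c * c ^ k * b ^ k)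
      heavy = begin
        2 * (2 * (T * a ^ k) * (Z * Z ^ k))   ≡⟨ shuffle T (a ^ k) Z (Z ^ k) ⟩
        Z * (4 * T * a ^ k * Z ^ k)           ≤⟨ *-mono-≤ Z≤2c powers ⟩
        2 * c * (c ^ k * b ^ k)               ≡⟨ assoc c (c ^ k) (b ^ k) ⟩
        2 * (c * c ^ k * b ^ k)               ∎
        where
        shuffle : ∀ t e z w → 2 * (2 * (t * e) * (z * w)) ≡ z * (4 * t * e * w)
        shuffle = solve-∀
        assoc : ∀ p q r → 2 * p * (q * r) ≡ 2 * (p * q * r)
        assoc = solve-∀

-- Conjunctions of independent tests

allPass : List (Test A B S) → A → B → ℕ
allPass []       x y = 1
allPass (t ∷ ts) x y = passes t x y * allPass ts x y

allRuns : List (Test A B S) → ℕ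
allRuns []       = 1
allRuns (t ∷ ts) = runs t * allRuns ts

allPass≤allRuns : ∀ (ts : List (Test A B S)) x y → allPass ts x y ≤ allRuns ts
allPass≤allRuns []       x y = ≤-refl
allPass≤allRuns (t ∷ ts) x y = *-mono-≤ (passes≤ t x y) (allPass≤allRuns ts x y)

allRuns>0 : ∀ (ts : List (Test A B S)) → 0 < allRuns ts
allRuns>0 []       = ≤-refl
allRuns>0 (t ∷ ts) = *-mono-≤ (runs>0 t) (allRuns>0 ts)

RectSum-allPass : ∀ (ts : List (Test A B S)) → RectSum A B (S ^ length ts) (allPass ts)
RectSum-allPass []       = RectSum-1
RectSum-allPass (t ∷ ts) = RectSum-* (rectSums t) (RectSum-allPass ts)

conjunction : 0 < S → ∀ T (ts : List (Test A B S)) → length ts ≤ T → Test A B (S ^ T)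
conjunction S>0 T ts l .passes   = allPass ts
conjunction S>0 T ts l .runs     = allRuns ts
conjunction S>0 T ts l .passes≤  = allPass≤allRuns ts
conjunction S>0 T ts l .runs>0   = allRuns>0 ts
conjunction {S = S} S>0 T ts l .rectSums =
  RectSum-weaken (^-monoʳ-≤ S {{>-nonZero S>0}} l) (RectSum-allPass ts)

-- The union bound: rejection probabilities of at most e / B′ add up over the list.
allPass-low : ∀ (ts : List (Test A B S)) B′ e x y →
              (∀ t → t ∈ ts → runs t * B′ ≤ passes t x y * B′ + e * runs t) →
              allRuns ts * B′ ≤ allPass ts x y * B′ + length ts * e * allRuns ts
allPass-low []       B′ e x y low = m≤m+n _ _
allPass-low (t ∷ ts) B′ e x y low = begin
  Z * Zs * B′                              ≡⟨ *-assoc Z Zs B′ ⟩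
  Z * (Zs * B′)                            ≤⟨ *-monoʳ-≤ Z (allPass-low ts B′ e x y (λ t′ t′∈ → low t′ (there t′∈))) ⟩
  Z * (gs * B′ + l * e * Zs)               ≡⟨ expand₁ Z gs B′ (l * e) Zs ⟩
  gs * (Z * B′) + l * e * (Z * Zs)         ≤⟨ +-monoˡ-≤ _ (*-monoʳ-≤ gs (low t (here refl))) ⟩
  gs * (g * B′ + e * Z) + l * e * (Z * Zs) ≡⟨ expand₂ gs g B′ e Z (l * e * (Z * Zs)) ⟩
  g * gs * B′ + (e * (Z * gs) + l * e * (Z * Zs))
    ≤⟨ +-monoʳ-≤ (g * gs * B′) (+-monoˡ-≤ _ (*-monoʳ-≤ e (*-monoʳ-≤ Z (allPass≤allRuns ts x y)))) ⟩
  g * gs * B′ + (e * (Z * Zs) + l * e * (Z * Zs))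
    ≡⟨ cong (g * gs * B′ +_) (*-distribʳ-+ (Z * Zs) e (l * e)) ⟨
  g * gs * B′ + suc l * e * (Z * Zs)       ∎
  where
  open ≤-Reasoning
  Z  = runs t
  Zs = allRuns ts
  g  = passes t x y
  gs = allPass ts x y
  l  = length ts
  expand₁ : ∀ z g b e w → z * (g * b + e * w) ≡ g * (z * b) + e * (z * w)
  expand₁ = solve-∀
  expand₂ : ∀ h g b e z w → h * (g * b + e * z) + w ≡ g * h * b + (e * (z * h) + w)
  expand₂ = solve-∀

-- A conjunction accepts no more often than each of its members, so a strict bound on its rejection
-- probability passes to every one of them.
allPass-high : ∀ (ts : List (Test A B S)) B′ φ x y →
               allRuns ts * B′ < allPass ts x y * B′ + φ * allRuns ts →
               ∀ t → t ∈ ts → runs t * B′ < passes t x y * B′ + φ * runs t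
allPass-high (t ∷ ts) B′ φ x y pass t′ t′∈ with t′∈
... | here refl = *-cancelʳ-< Zs _ _ (begin-strict
  Z * B′ * Zs                              ≡⟨ last Z B′ Zs ⟩
  Z * Zs * B′                              <⟨ pass ⟩
  g * gs * B′ + φ * (Z * Zs)               ≤⟨ +-monoˡ-≤ _ (*-monoˡ-≤ B′ (*-monoʳ-≤ g (allPass≤allRuns ts x y))) ⟩
  g * Zs * B′ + φ * (Z * Zs)               ≡⟨ collect g Zs B′ φ Z ⟩
  (g * B′ + φ * Z) * Zs                    ∎)
  where
  open ≤-Reasoning
  Z  = runs t
  Zs = allRuns ts
  g  = passes t x y
  gs = allPass ts x y
  last : ∀ p q r → p * q * r ≡ p * r * q
  last = solve-∀
  collect : ∀ g z b f w → g * z * b + f * (w * z) ≡ (g * b + f * w) * z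
  collect = solve-∀
... | there t′∈ts = allPass-high ts B′ φ x y (*-cancelˡ-< Z _ _ (begin-strict
  Z * (Zs * B′)                            ≡⟨ *-assoc Z Zs B′ ⟨
  Z * Zs * B′                              <⟨ pass ⟩
  g * gs * B′ + φ * (Z * Zs)               ≤⟨ +-monoˡ-≤ _ (*-monoˡ-≤ B′ (*-monoˡ-≤ gs (passes≤ t x y))) ⟩
  Z * gs * B′ + φ * (Z * Zs)               ≡⟨ collect Z gs B′ φ Zs ⟩
  Z * (gs * B′ + φ * Zs)                   ∎)) t′ t′∈ts
  where
  open ≤-Reasoning
  Z  = runs t
  Zs = allRuns ts
  g  = passes t x y
  gs = allPass ts x y
  collect : ∀ z h b f w → z * h * b + f * (z * w) ≡ z * (h * b + f * w)
  collect = solve-∀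

-- Amplification

-- Bernoulli's inequality for (1 + 1/u)^j, multiplied by u ^ (j + 1).
bernoulli : ∀ u j → (u + j) * u ^ j ≤ u * suc u ^ j
bernoulli u zero    = ≤-reflexive (cong (_* 1) (+-identityʳ u))
bernoulli u (suc j) = begin
  (u + suc j) * (u * u ^ j)                      ≤⟨ m≤m+n _ (j * u ^ j) ⟩
  (u + suc j) * (u * u ^ j) + j * u ^ j          ≡⟨ regroup u j (u ^ j) ⟩
  (u + j) * u ^ j * suc u                        ≤⟨ *-monoˡ-≤ (suc u) (bernoulli u j) ⟩
  u * suc u ^ j * suc u                          ≡⟨ *-assoc u _ _ ⟩
  u * (suc u ^ j * suc u)                        ≡⟨ cong (u *_) (*-comm _ (suc u)) ⟩
  u * suc u ^ suc j                              ∎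
  where
  open ≤-Reasoning
  regroup : ∀ u j w → (u + suc j) * (u * w) + j * w ≡ (u + j) * w * suc u
  regroup = solve-∀

2*u^u≤suc-u^u : ∀ u → 0 < u → 2 * u ^ u ≤ suc u ^ u
2*u^u≤suc-u^u u u>0 = *-cancelˡ-≤ u {{>-nonZero u>0}} (begin
  u * (2 * u ^ u)    ≡⟨ regroup u (u ^ u) ⟩
  (u + u) * u ^ u    ≤⟨ bernoulli u u ⟩
  u * suc u ^ u      ∎)
  where
  open ≤-Reasoning
  regroup : ∀ u w → u * (2 * w) ≡ (u + u) * w
  regroup = solve-∀

-- As (1 + 1/u)^u ≥ 2, every u repetitions double a ratio d / e of at least 1 + 1/u.
ratio-power : ∀ u d e L → 0 < u → suc u * e ≤ u * d → 2 ^ L * e ^ (u * L) ≤ d ^ (u * L)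
ratio-power u d e L u>0 gap = begin
  2 ^ L * e ^ (u * L)      ≡⟨ cong (2 ^ L *_) (^-*-assoc e u L) ⟨
  2 ^ L * (e ^ u) ^ L      ≡⟨ ^-distribʳ-* L 2 (e ^ u) ⟨
  (2 * e ^ u) ^ L          ≤⟨ ^-monoˡ-≤ L double ⟩
  (d ^ u) ^ L              ≡⟨ ^-*-assoc d u L ⟩
  d ^ (u * L)              ∎
  where
  open ≤-Reasoning
  regroup : ∀ w e → w * (2 * e) ≡ 2 * w * e
  regroup = solve-∀
  double : 2 * e ^ u ≤ d ^ u
  double = *-cancelˡ-≤ (u ^ u) {{m^n≢0 u u {{>-nonZero u>0}}}} (begin
    u ^ u * (2 * e ^ u)    ≡⟨ regroup (u ^ u) (e ^ u) ⟩
    2 * u ^ u * e ^ u      ≤⟨ *-monoˡ-≤ (e ^ u) (2*u^u≤suc-u^u u u>0) ⟩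
    suc u ^ u * e ^ u      ≡⟨ ^-distribʳ-* u (suc u) e ⟨
    (suc u * e) ^ u        ≤⟨ ^-monoˡ-≤ u gap ⟩
    (u * d) ^ u            ≡⟨ ^-distribʳ-* u u d ⟩
    u ^ u * d ^ u          ∎)

-- The popular set gives H > N RD / (W BK), and corruption gives H ≤ c V + s. The error s is at most
-- half of that lower bound, so c V exceeds N RD / (2 W BK); the gap between RD and RE then pays for
-- the factor 2 W c.
planted-mass : ∀ N W G H V BK RD RE c s → 0 < RD → N < W * G → RD * G ≤ BK * H → H ≤ c * V + s →
          2 * W * c * RE ≤ RD → 2 * W * BK * s ≤ N * RD → N * RE < BK * V
planted-mass N W G H V BK RD RE c s RD>0 popular lower corr gap small =
  *-cancelˡ-< (2 * W * c) _ _ (begin-strict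
    2 * W * c * (N * RE)     ≡⟨ exchange (2 * W * c) N RE ⟩
    N * (2 * W * c * RE)     ≤⟨ *-monoʳ-≤ N gap ⟩
    N * RD                   <⟨ +-cancelʳ-< (N * RD) _ _ main ⟩
    2 * W * c * (BK * V)     ∎)
  where
  open ≤-Reasoning
  exchange : ∀ a n r → a * (n * r) ≡ n * (a * r)
  exchange = solve-∀
  double : ∀ n r → n * r + n * r ≡ 2 * n * r
  double = solve-∀
  move : ∀ w g r → 2 * (w * g) * r ≡ 2 * w * (r * g)
  move = solve-∀
  spread : ∀ w b c v s → 2 * w * (b * (c * v + s)) ≡ 2 * w * c * (b * v) + 2 * w * b * s
  spread = solve-∀
  main : N * RD + N * RD < 2 * W * c * (BK * V) + N * RD
  main = begin-strict
    N * RD + N * RD                              ≡⟨ double N RD ⟩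
    2 * N * RD                                   <⟨ *-monoˡ-< RD {{>-nonZero RD>0}} (*-monoʳ-< 2 popular) ⟩
    2 * (W * G) * RD                             ≡⟨ move W G RD ⟩
    2 * W * (RD * G)                             ≤⟨ *-monoʳ-≤ (2 * W) lower ⟩
    2 * W * (BK * H)                             ≤⟨ *-monoʳ-≤ (2 * W) (*-monoʳ-≤ BK corr) ⟩
    2 * W * (BK * (c * V + s))                   ≡⟨ spread W BK c V s ⟩
    2 * W * c * (BK * V) + 2 * W * BK * s        ≤⟨ +-monoʳ-≤ _ small ⟩
    2 * W * c * (BK * V) + N * RD                ∎

ι*-mono-< : ∀ b x y → ι b * x < ι b * y → b ≡ true × x < y
ι*-mono-< true  x y lt = refl , +-cancelʳ-< 0 x y lt

^-cancelˡ-< : ∀ k {x y} → x ^ k < y ^ k → x < y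
^-cancelˡ-< k lt = ≰⇒> (λ y≤x → <⇒≱ lt (^-monoˡ-≤ k y≤x))

does-true : ∀ {P : Set} (P? : Dec P) → does P? ≡ true → P
does-true (yes p) _ = p

-- Put δ = f / B, so that e / B = 1 - 2δ. Some colour has a dense set of pairs accepted with
-- probability at least 1 - δ. Over K = u * L repetitions this beats (1 - 2δ)^K by 2 ^ L, which
-- covers both the density of the set and the loss in the corruption bound. Hence not all planted
-- pairs can be accepted with probability at most 1 - 2δ.
planted-pair : ∀ {Σ Colour : Set} {m S : ℕ} (_≟_ : DecidableEquality Σ) (E : List Σ) → (∀ z → z ∈ E) →
  ∀ q → length E ≡ q + q → 1 ≤ m * length E →
  ∀ (colours : List Colour) (T : Colour → Test (Vec Σ m) (Vec Σ m) S)
    (π : Colour → Σ → Σ) → (∀ c → Invariant E (π c)) →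
  ∀ f e B u W L → f + f + e ≡ B → 0 < u → 0 < f → B ≤ u * f → length colours < W →
  2 * W * (2 * (m * length E) * (2 * (m * length E))) ≤ 2 ^ L →
  8 * W * S ^ (u * L) * 2 ^ (u * L) ≤ 4 ^ m →
  (∀ x y → ∃ λ c → c ∈ colours ×
     runs (T c) * B ≤ passes (T c) x y * B + f * runs (T c)) →
  ∃ λ c → ∃ λ x → ∃ λ y → ∃ (λ a → lookup y a ≡ π c (lookup x a)) ×
     runs (T c) * B < passes (T c) x y * B + 2 * f * runs (T c)
planted-pair {Σ} {Colour} {m} {S} _≟_ E ∈E q |E|≡2q 1≤mE colours T π inv f e _ u W L refl u>0 f>0 base≤uf few gap small low =
  c , x , y , does-true (any? _) (proj₁ at) , passing
  where
  open ≤-Reasoning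
  Ω = vecs E m
  base = f + f + e
  d = f + e
  K = u * L
  total = ∑ Ω (λ _ → ∑ Ω (λ _ → 1))
  low? : ∀ c x y → Dec (runs (T c) * d ≤ passes (T c) x y * base)
  low? c x y = _ ≤? _
  G : Colour → ℕ
  G c = ∑ Ω (λ x → ∑ Ω (λ y → ι (does (low? c x y))))

  total≡ : total ≡ 4 ^ m * (q * q) ^ m
  total≡ = begin-equality
    total                                    ≡⟨ ∑-const Ω _ ⟩
    length Ω * ∑ Ω (λ _ → 1)             ≡⟨ cong (length Ω *_) (length-∑ Ω) ⟨
    length Ω * length Ω                  ≡⟨ cong₂ _*_ |Ω| |Ω| ⟩
    (q + q) ^ m * (q + q) ^ m            ≡⟨ ^-distribʳ-* m (q + q) (q + q) ⟨
    ((q + q) * (q + q)) ^ m              ≡⟨ cong (_^ m) (square q) ⟩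
    (4 * (q * q)) ^ m                    ≡⟨ ^-distribʳ-* m 4 (q * q) ⟩
    4 ^ m * (q * q) ^ m                  ∎
    where
    |Ω| : length Ω ≡ (q + q) ^ m
    |Ω| = trans (length-vecs E m) (cong (_^ m) |E|≡2q)
    square : ∀ q → (q + q) * (q + q) ≡ 4 * (q * q)
    square = solve-∀

  q>0 : 0 < q
  q>0 = n≢0⇒n>0 (λ { refl → <⇒≱ 1≤mE (≤-reflexive (trans (cong (m *_) |E|≡2q) (*-zeroʳ m))) })

  total>0 : 0 < total
  total>0 = subst (0 <_) (sym total≡) (*-mono-≤ (m^n>0 4 m)
    (m^n>0 (q * q) {{>-nonZero (*-mono-≤ q>0 q>0)}} m))

  covered : ∀ x y → 1 ≤ ∑ colours (λ c → ι (does (low? c x y)))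
  covered x y with low x y
  ... | c , c∈ , lowc = ≤-trans (≤-reflexive (cong ι (sym (dec-true (low? c x y) (+-cancelˡ-≤ (f * runs (T c)) _ _ (begin
    f * runs (T c) + runs (T c) * d     ≡⟨ regroup f (runs (T c)) e ⟩
    runs (T c) * base                      ≤⟨ lowc ⟩
    passes (T c) x y * base + f * runs (T c) ≡⟨ +-comm _ (f * runs (T c)) ⟩
    f * runs (T c) + passes (T c) x y * base ∎))))))
    (∈⇒≤∑ c∈ (λ c → ι (does (low? c x y))))
    where
    regroup : ∀ f r e → f * r + r * (f + e) ≡ r * (f + f + e)
    regroup = solve-∀

  -- Averaging: by `covered` the sets of low pairs add up to at least `total`, and there are fewer
  -- than `W` of them.
  popular : ∃ λ c → total < W * G c
  popular = ∑-<⇒∃ colours (λ _ → total) (λ c → W * G c) (begin-strict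
    ∑ colours (λ _ → total)                ≡⟨ ∑-const colours total ⟩
    length colours * total                 <⟨ *-monoˡ-< total {{>-nonZero total>0}} few ⟩
    W * total                              ≤⟨ *-monoʳ-≤ W (∑-mono Ω (λ x → ∑-mono Ω (covered x))) ⟩
    W * ∑ Ω (λ x → ∑ Ω (λ y → ∑ colours (λ c → ι (does (low? c x y)))))
      ≡⟨ cong (W *_) (∑-cong Ω (λ x → ∑-swap Ω colours _)) ⟩
    W * ∑ Ω (λ x → ∑ colours (λ c → ∑ Ω (λ y → ι (does (low? c x y)))))
      ≡⟨ cong (W *_) (∑-swap Ω colours _) ⟩
    W * ∑ colours G                    ≡⟨ ∑-*ˡ colours W G ⟨
    ∑ colours (λ c → W * G c)          ∎)

  c = proj₁ popular
  r = runs (T c)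
  p = passes (T c)
  w : Vec Σ m → Vec Σ m → Bool
  w = planted _≟_ (π c)
  H = ∑ Ω (λ x → ∑ Ω (λ y → p x y ^ K))
  V = ∑ Ω (λ x → ∑ Ω (λ y → ι (w x y) * p x y ^ K))

  d>0 : 0 < d
  d>0 = ≤-trans f>0 (m≤m+n f e)

  ∑∑-*ˡ : ∀ k (h : Vec Σ m → Vec Σ m → ℕ) → ∑ Ω (λ x → ∑ Ω (λ y → k * h x y)) ≡ k * ∑ Ω (λ x → ∑ Ω (h x))
  ∑∑-*ˡ k h = trans (∑-cong Ω (λ x → ∑-*ˡ Ω k (h x))) (∑-*ˡ Ω k _)

  lower : (r * d) ^ K * G c ≤ base ^ K * H
  lower = begin
    (r * d) ^ K * G c
      ≡⟨ ∑∑-*ˡ ((r * d) ^ K) _ ⟨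
    ∑ Ω (λ x → ∑ Ω (λ y → (r * d) ^ K * ι (does (low? c x y))))
      ≤⟨ ∑-mono Ω (λ x → ∑-mono Ω (λ y → term x y)) ⟩
    ∑ Ω (λ x → ∑ Ω (λ y → base ^ K * p x y ^ K))
      ≡⟨ ∑∑-*ˡ (base ^ K) _ ⟩
    base ^ K * H ∎
    where
    indicator : ∀ {P : Set} (P? : Dec P) a b → (P → a ≤ b) → a * ι (does P?) ≤ b
    indicator (yes h) a b a≤b = ≤-trans (≤-reflexive (*-identityʳ a)) (a≤b h)
    indicator (no _)  a b _   = ≤-trans (≤-reflexive (*-zeroʳ a)) z≤n
    term : ∀ x y → (r * d) ^ K * ι (does (low? c x y)) ≤ base ^ K * p x y ^ K
    term x y = indicator (low? c x y) _ _ (λ low-at → begin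
      (r * d) ^ K            ≤⟨ ^-monoˡ-≤ K low-at ⟩
      (p x y * base) ^ K        ≡⟨ ^-distribʳ-* K (p x y) base ⟩
      p x y ^ K * base ^ K      ≡⟨ *-comm (p x y ^ K) _ ⟩
      base ^ K * p x y ^ K      ∎)

  gap′ : 2 * W * (2 * (m * length E) * (2 * (m * length E))) * (r * e) ^ K ≤ (r * d) ^ K
  gap′ = begin
    2 * W * (2 * (m * length E) * (2 * (m * length E))) * (r * e) ^ K
      ≤⟨ *-monoˡ-≤ ((r * e) ^ K) gap ⟩
    2 ^ L * (r * e) ^ K            ≡⟨ cong (2 ^ L *_) (^-distribʳ-* K r e) ⟩
    2 ^ L * (r ^ K * e ^ K)        ≡⟨ exchange (2 ^ L) (r ^ K) (e ^ K) ⟩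
    r ^ K * (2 ^ L * e ^ K)        ≤⟨ *-monoʳ-≤ (r ^ K) (ratio-power u d e L u>0 widen) ⟩
    r ^ K * d ^ K                  ≡⟨ ^-distribʳ-* K r d ⟨
    (r * d) ^ K                    ∎
    where
    exchange : ∀ a b c → a * (b * c) ≡ b * (a * c)
    exchange = solve-∀
    -- As a ratio, d / e = 1 + f / e, and f / e ≥ f / base ≥ 1 / u.
    widen : suc u * e ≤ u * d
    widen = begin
      e + u * e          ≤⟨ +-monoˡ-≤ (u * e) (≤-trans (m≤n+m e (f + f)) base≤uf) ⟩
      u * f + u * e      ≡⟨ *-distribˡ-+ u f e ⟨
      u * d              ∎

  small′ : 2 * W * base ^ K * (S ^ K * (4 * (q * q) ^ m)) ≤ total * (r * d) ^ K
  small′ = begin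
    2 * W * base ^ K * (S ^ K * (4 * (q * q) ^ m))
      ≤⟨ *-monoˡ-≤ (S ^ K * (4 * (q * q) ^ m)) (*-monoʳ-≤ (2 * W) (^-monoˡ-≤ K base≤2d)) ⟩
    2 * W * (2 * d) ^ K * (S ^ K * (4 * (q * q) ^ m))
      ≡⟨ cong (λ t → 2 * W * t * (S ^ K * (4 * (q * q) ^ m))) (^-distribʳ-* K 2 d) ⟩
    2 * W * (2 ^ K * d ^ K) * (S ^ K * (4 * (q * q) ^ m))
      ≡⟨ regroup W (2 ^ K) (d ^ K) (S ^ K) ((q * q) ^ m) ⟩
    8 * W * S ^ K * 2 ^ K * ((q * q) ^ m * d ^ K)
      ≤⟨ *-mono-≤ small (*-monoʳ-≤ ((q * q) ^ m) (^-monoˡ-≤ K d≤rd)) ⟩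
    4 ^ m * ((q * q) ^ m * (r * d) ^ K)
      ≡⟨ *-assoc (4 ^ m) _ _ ⟨
    4 ^ m * (q * q) ^ m * (r * d) ^ K
      ≡⟨ cong (_* (r * d) ^ K) total≡ ⟨
    total * (r * d) ^ K ∎
    where
    regroup : ∀ w t d s j → 2 * w * (t * d) * (s * (4 * j)) ≡ 8 * w * s * t * (j * d)
    regroup = solve-∀
    twice : ∀ f e → f + f + e + e ≡ 2 * (f + e)
    twice = solve-∀
    -- Acceptance on low pairs has probability at least 1/2, so replacing `base ^ K` by `d ^ K`
    -- costs the factor `2 ^ K` that `small` provides for.
    base≤2d : base ≤ 2 * d
    base≤2d = ≤-trans (m≤m+n base e) (≤-reflexive (twice f e))
    d≤rd : d ≤ r * d
    d≤rd = m≤n*m d r {{>-nonZero (runs>0 (T c))}}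

  -- If `p x y * base ≤ r * e` held on every planted pair, the right side could not exceed the left.
  -- The left side is bounded by the sum over all pairs.
  more : ∑ Ω (λ x → ∑ Ω (λ y → ι (w x y) * (r * e) ^ K)) < ∑ Ω (λ x → ∑ Ω (λ y → ι (w x y) * (p x y * base) ^ K))
  more = begin-strict
    ∑ Ω (λ x → ∑ Ω (λ y → ι (w x y) * (r * e) ^ K))
      ≤⟨ ∑-mono Ω (λ x → ∑-mono Ω (λ y → ≤-trans (*-monoˡ-≤ ((r * e) ^ K) (ι≤1 (w x y))) (≤-reflexive (*-comm 1 ((r * e) ^ K))))) ⟩
    ∑ Ω (λ x → ∑ Ω (λ y → (r * e) ^ K * 1))
      ≡⟨ ∑∑-*ˡ ((r * e) ^ K) (λ _ _ → 1) ⟩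
    (r * e) ^ K * total
      ≡⟨ *-comm ((r * e) ^ K) total ⟩
    total * (r * e) ^ K
      <⟨ planted-mass total W (G c) H V (base ^ K) ((r * d) ^ K) ((r * e) ^ K) _ _
           (m^n>0 (r * d) {{>-nonZero (*-mono-≤ (runs>0 (T c)) d>0)}} K)
           (proj₂ popular) lower
           (corruption-∑ _≟_ E ∈E q |E|≡2q (π c) (inv c) 1≤mE (RectSum-^ K (rectSums (T c))))
           gap′ small′ ⟩
    base ^ K * V
      ≡⟨ ∑∑-*ˡ (base ^ K) _ ⟨
    ∑ Ω (λ x → ∑ Ω (λ y → base ^ K * (ι (w x y) * p x y ^ K)))
      ≡⟨ ∑-cong Ω (λ x → ∑-cong Ω (λ y → trans (rotate (base ^ K) (ι (w x y)) (p x y ^ K))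
           (cong (ι (w x y) *_) (sym (^-distribʳ-* K (p x y) base))))) ⟩
    ∑ Ω (λ x → ∑ Ω (λ y → ι (w x y) * (p x y * base) ^ K)) ∎
    where
    rotate : ∀ b w p → b * (w * p) ≡ w * (p * b)
    rotate = solve-∀

  row = ∑-<⇒∃ Ω _ _ more
  x = proj₁ row
  cell = ∑-<⇒∃ Ω _ _ (proj₂ row)
  y = proj₁ cell
  at = ι*-mono-< (w x y) _ _ (proj₂ cell)

  passing : r * base < p x y * base + 2 * f * r
  passing = begin-strict
    r * base                  ≡⟨ split r f e ⟩
    r * e + 2 * f * r      <⟨ +-monoˡ-< (2 * f * r) (^-cancelˡ-< K (proj₂ at)) ⟩
    p x y * base + 2 * f * r  ∎
    where
    split : ∀ r f e → r * (f + f + e) ≡ r * e + 2 * f * r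
    split = solve-∀

-- Protocols as families of rectangles

∑-concatMap : ∀ (g : I → List A) (is : List I) (f : A → ℕ) → ∑ (concatMap g is) f ≡ ∑ is (λ i → ∑ (g i) f)
∑-concatMap g []       f = refl
∑-concatMap g (i ∷ is) f = trans (∑-++ (g i) _ f) (cong (∑ (g i) f +_) (∑-concatMap g is f))

length-filter-∑ : ∀ {P : A → Set} (P? : Decidable P) xs → length (filter P? xs) ≡ ∑ xs (λ x → ι (does (P? x)))
length-filter-∑ P? [] = refl
length-filter-∑ P? (x ∷ xs) with P? x
... | yes _ = cong suc (length-filter-∑ P? xs)
... | no  _ = length-filter-∑ P? xs

length-allStrings : ∀ r → length (allStrings r) ≡ 2 ^ r
length-allStrings zero    = refl
length-allStrings (suc r) = begin
  length (map (true ∷_) (allStrings r) ++ map (false ∷_) (allStrings r))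
    ≡⟨ length-++ (map (true ∷_) (allStrings r)) ⟩
  length (map (true ∷_) (allStrings r)) + length (map (false ∷_) (allStrings r))
    ≡⟨ cong₂ _+_ (half true) (half false) ⟩
  2 ^ r + 2 ^ r
    ≡⟨ cong (2 ^ r +_) (+-identityʳ (2 ^ r)) ⟨
  2 ^ suc r ∎
  where
  open ≡-Reasoning
  half : ∀ b → length (map (b ∷_) (allStrings r)) ≡ 2 ^ r
  half b = trans (length-map (b ∷_) (allStrings r)) (length-allStrings r)

onAlice : (A → Bool) → O × Rect A B → O × Rect A B
onAlice f (o , p , q) = o , (λ x → f x ∧ p x) , q

onBob : (B → Bool) → O × Rect A B → O × Rect A B
onBob g (o , p , q) = o , p , (λ y → g y ∧ q y)

leaves : Protocol A B O → List (O × Rect A B)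
leaves (leaf o)      = (o , (λ _ → true) , (λ _ → true)) ∷ []
leaves (alice f l r) = map (onAlice f) (leaves l) ++ map (onAlice (not ∘ f)) (leaves r)
leaves (bob g l r)   = map (onBob g) (leaves l) ++ map (onBob (not ∘ g)) (leaves r)

length-branch : ∀ {X Y : Set} {d e} (xs ys : List X) (f g : X → Y) → length xs ≤ 2 ^ d → length ys ≤ 2 ^ e →
                length (map f xs ++ map g ys) ≤ 2 ^ suc (d ⊔ e)
length-branch {d = d} {e} xs ys f g xs≤ ys≤ = begin
  length (map f xs ++ map g ys)          ≡⟨ length-++ (map f xs) ⟩
  length (map f xs) + length (map g ys)  ≡⟨ cong₂ _+_ (length-map f xs) (length-map g ys) ⟩
  length xs + length ys                  ≤⟨ +-mono-≤ (≤-trans xs≤ (^-monoʳ-≤ 2 (m≤m⊔n d e))) (≤-trans ys≤ (^-monoʳ-≤ 2 (m≤n⊔m d e))) ⟩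
  2 ^ (d ⊔ e) + 2 ^ (d ⊔ e)              ≡⟨ cong (2 ^ (d ⊔ e) +_) (+-identityʳ _) ⟨
  2 ^ suc (d ⊔ e)                        ∎
  where open ≤-Reasoning

length-leaves : ∀ (P : Protocol A B O) → length (leaves P) ≤ 2 ^ depth P
length-leaves (leaf o)      = ≤-refl
length-leaves (alice f l r) = length-branch {d = depth l} {depth r} (leaves l) (leaves r) _ _ (length-leaves l) (length-leaves r)
length-leaves (bob g l r)   = length-branch {d = depth l} {depth r} (leaves l) (leaves r) _ _ (length-leaves l) (length-leaves r)

∑-branch : ∀ {X Y : Set} (xs ys : List X) (f g : X → Y) (φ : Y → ℕ) →
           ∑ (map f xs ++ map g ys) φ ≡ ∑ xs (φ ∘ f) + ∑ ys (φ ∘ g)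
∑-branch xs ys f g φ = trans (∑-++ (map f xs) _ φ) (cong₂ _+_ (∑-map f xs φ) (∑-map g ys φ))

-- Exactly one leaf rectangle contains (x , y): at each node the indicator of the branch not taken
-- vanishes.
∑-leaves : ∀ (P : Protocol A B O) (φ : O → ℕ) x y →
           ∑ (leaves P) (λ (o , r) → φ o * ⟦ r ⟧ x y) ≡ φ (run P x y)
∑-leaves (leaf o) φ x y = trans (+-identityʳ _) (*-identityʳ (φ o))
∑-leaves (alice f l r) φ x y
  rewrite ∑-branch (leaves l) (leaves r) (onAlice f) (onAlice (not ∘ f)) (λ (o , r) → φ o * ⟦ r ⟧ x y)
  with f x
... | true  = trans (cong₂ _+_ (∑-leaves l φ x y)
                (trans (∑-cong (leaves r) (λ (o , _) → *-zeroʳ (φ o))) (∑-zero (leaves r)))) (+-identityʳ _)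
... | false = cong₂ _+_ (trans (∑-cong (leaves l) (λ (o , _) → *-zeroʳ (φ o))) (∑-zero (leaves l)))
                (∑-leaves r φ x y)
∑-leaves (bob g l r) φ x y
  rewrite ∑-branch (leaves l) (leaves r) (onBob g) (onBob (not ∘ g)) (λ (o , r) → φ o * ⟦ r ⟧ x y)
  with g y
... | true  = trans (cong₂ _+_ (∑-leaves l φ x y)
                (trans (∑-cong (leaves r) (λ (o , p , _) → trans (cong (φ o *_) (*-zeroʳ (ι (p x)))) (*-zeroʳ (φ o)))) (∑-zero (leaves r)))) (+-identityʳ _)
... | false = cong₂ _+_ (trans (∑-cong (leaves l) (λ (o , p , _) → trans (cong (φ o *_) (*-zeroʳ (ι (p x)))) (*-zeroʳ (φ o)))) (∑-zero (leaves l)))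
                (∑-leaves r φ x y)

∑-2^≤ : ∀ (is : List I) (g f : I → ℕ) → (∀ i → g i ≤ 2 ^ f i) →
        ∑ is g ≤ length is * 2 ^ foldr _⊔_ 0 (map f is)
∑-2^≤ []       g f g≤ = z≤n
∑-2^≤ (i ∷ is) g f g≤ = +-mono-≤ (≤-trans (g≤ i) (^-monoʳ-≤ 2 (m≤m⊔n (f i) _)))
  (≤-trans (∑-2^≤ is g f g≤) (*-monoʳ-≤ (length is) (^-monoʳ-≤ 2 (m≤n⊔m (f i) _))))

seedLeaves : RandProtocol A B O → List (O × Rect A B)
seedLeaves Q = concatMap (leaves ∘ proto Q) (allStrings (bits Q))

∑-seedLeaves : ∀ (Q : RandProtocol A B O) (φ : O → ℕ) x y →
               ∑ (seedLeaves Q) (λ (o , r) → φ o * ⟦ r ⟧ x y) ≡ ∑ (allStrings (bits Q)) (λ ρ → φ (run (proto Q ρ) x y))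
∑-seedLeaves Q φ x y = trans (∑-concatMap _ (allStrings (bits Q)) _)
  (∑-cong (allStrings (bits Q)) (λ ρ → ∑-leaves (proto Q ρ) φ x y))

-- Complexity adds random bits and worst depth, so 2 ^ complexity bounds the number of (seed, leaf)
-- pairs.
family : (Q : RandProtocol A B O) → complexity Q ≤ budget → Family A B O (2 ^ budget)
family Q _ .rects = seedLeaves Q
family Q _ .seeds = 2 ^ bits Q
family Q _ .cover x y = begin
  ∑ (seedLeaves Q) (λ (_ , r) → ⟦ r ⟧ x y)
    ≡⟨ ∑-cong (seedLeaves Q) (λ (_ , r) → *-identityˡ (⟦ r ⟧ x y)) ⟨
  ∑ (seedLeaves Q) (λ (_ , r) → 1 * ⟦ r ⟧ x y)
    ≡⟨ ∑-seedLeaves Q (λ _ → 1) x y ⟩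
  ∑ (allStrings (bits Q)) (λ _ → 1)
    ≡⟨ length-∑ (allStrings (bits Q)) ⟨
  length (allStrings (bits Q))
    ≡⟨ length-allStrings (bits Q) ⟩
  2 ^ bits Q ∎
  where open ≡-Reasoning
family Q _ .seeds>0 = m^n>0 2 (bits Q)
family {budget = budget} Q Q≤c .size = begin
  length (seedLeaves Q)
    ≡⟨ length-∑ (seedLeaves Q) ⟩
  ∑ (seedLeaves Q) (λ _ → 1)
    ≡⟨ ∑-concatMap _ ρs _ ⟩
  ∑ ρs (λ ρ → ∑ (leaves (proto Q ρ)) (λ _ → 1))
    ≡⟨ ∑-cong ρs (λ ρ → length-∑ (leaves (proto Q ρ))) ⟨
  ∑ ρs (λ ρ → length (leaves (proto Q ρ)))
    ≤⟨ ∑-2^≤ ρs _ (λ ρ → depth (proto Q ρ)) (λ ρ → length-leaves (proto Q ρ)) ⟩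
  length ρs * 2 ^ cost
    ≡⟨ cong (_* 2 ^ cost) (length-allStrings (bits Q)) ⟩
  2 ^ bits Q * 2 ^ cost
    ≡⟨ ^-distribˡ-+-* 2 (bits Q) cost ⟨
  2 ^ complexity Q
    ≤⟨ ^-monoʳ-≤ 2 Q≤c ⟩
  2 ^ budget ∎
  where
  open ≤-Reasoning
  ρs = allStrings (bits Q)
  cost = foldr _⊔_ 0 (map (λ ρ → depth (proto Q ρ)) ρs)

_≟S_ : ∀ {n} → DecidableEquality (BitString n)
_≟S_ = ≡-dec _≟B_

open module Count {n : ℕ} = Counting (_≟S_ {n}) public

count-family : ∀ {n} (Q : RandProtocol A B (BitString n)) (Q≤c : complexity Q ≤ budget) s x y →
               count (family Q Q≤c) s x y ≡
               length (filter (λ ρ → ≡-dec _≟B_ (run (proto Q ρ) x y) s) (allStrings (bits Q)))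
count-family Q Q≤c s x y = trans (∑-seedLeaves Q (λ o → same o s) x y)
  (sym (length-filter-∑ (λ ρ → run (proto Q ρ) x y ≟S s) (allStrings (bits Q))))

-- Bits and strings under xor

booleans : List Bool
booleans = true ∷ false ∷ []

∈-booleans : ∀ b → b ∈ booleans
∈-booleans true  = here refl
∈-booleans false = there (here refl)

xor-invariant : ∀ s → Invariant booleans (_xor s)
xor-invariant true  f = swap (f false) (f true)
  where
  swap : ∀ a b → a + (b + 0) ≡ b + (a + 0)
  swap = solve-∀
xor-invariant false f = refl

xor-cancelˡ : ∀ a b → a xor (a xor b) ≡ b
xor-cancelˡ true  true  = refl
xor-cancelˡ true  false = refl
xor-cancelˡ false b     = refl

⊕-cancelˡ : ∀ {n} (a b : BitString n) → a ⊕ (a ⊕ b) ≡ b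
⊕-cancelˡ []      []      = refl
⊕-cancelˡ (a ∷ v) (b ∷ w) = cong₂ _∷_ (xor-cancelˡ a b) (⊕-cancelˡ v w)

-- Parameters

n<2^n : ∀ n → n < 2 ^ n
n<2^n zero    = s≤s z≤n
n<2^n (suc n) = begin-strict
  suc n              ≤⟨ n<2^n n ⟩
  2 ^ n              <⟨ m<m+n (2 ^ n) (m^n>0 2 n) ⟩
  2 ^ n + 2 ^ n      ≡⟨ cong (2 ^ n +_) (+-identityʳ _) ⟨
  2 ^ suc n          ∎
  where open ≤-Reasoning

-- The threshold 1/2 + Σ_{i ≤ τ} 1/(10 i²) as the fraction num τ / den τ, so that P τ is the threshold τ + 1.

step num den : ℕ → ℕ
step τ = 10 * (suc τ * suc τ)
num zero    = 1
num (suc τ) = step τ * num τ + den τ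
den zero    = 2
den (suc τ) = step τ * den τ

num>0 : ∀ τ → 0 < num τ
num>0 zero    = ≤-refl
num>0 (suc τ) = ≤-trans (num>0 τ) (≤-trans (m≤n*m (num τ) (step τ)) (m≤m+n _ (den τ)))

den>0 : ∀ τ → 0 < den τ
den>0 zero    = s≤s z≤n
den>0 (suc τ) = ≤-trans (den>0 τ) (m≤n*m (den τ) (step τ))

den≤2num : ∀ τ → den τ ≤ 2 * num τ
den≤2num zero    = ≤-refl
den≤2num (suc τ) = begin
  step τ * den τ             ≤⟨ *-monoʳ-≤ (step τ) (den≤2num τ) ⟩
  step τ * (2 * num τ)       ≡⟨ exchange (step τ) (num τ) ⟩
  2 * (step τ * num τ)       ≤⟨ *-monoʳ-≤ 2 (m≤m+n (step τ * num τ) (den τ)) ⟩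
  2 * num (suc τ)            ∎
  where
  open ≤-Reasoning
  exchange : ∀ v a → v * (2 * a) ≡ 2 * (v * a)
  exchange = solve-∀

num≤den-pred : ∀ τ → num (suc τ) ≤ den (suc τ) → num τ ≤ den τ
num≤den-pred τ le = *-cancelˡ-≤ (step τ) (≤-trans (m≤m+n _ (den τ)) le)

-- Opaque because 2 ^ rounds τ would unfold to a term of exponential size.
opaque
  tests : ℕ → ℕ
  tests τ = suc τ * suc τ

  -- Every `step τ` rounds double the advantage of the next threshold over this one. The second
  -- factor is the number of doublings, chosen so that they exceed `4 * tests τ`.
  rounds : ℕ → ℕ
  rounds τ = step τ * (2 + (suc τ + suc τ))

  tests≡ : ∀ τ → tests τ ≡ τ * suc τ + suc τ
  tests≡ τ = +-comm (suc τ) (τ * suc τ)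

  rounds≡ : ∀ τ → rounds τ ≡ step τ * (2 + (suc τ + suc τ))
  rounds≡ τ = refl

  tests>0 : ∀ τ → 0 < tests τ
  tests>0 τ = s≤s z≤n

  4*tests≤ : ∀ τ → 4 * tests τ ≤ 2 ^ (2 + (suc τ + suc τ))
  4*tests≤ τ = begin
    4 * (suc τ * suc τ)               ≤⟨ *-monoʳ-≤ 4 (*-mono-≤ (<⇒≤ (n<2^n (suc τ))) (<⇒≤ (n<2^n (suc τ)))) ⟩
    4 * (2 ^ suc τ * 2 ^ suc τ)       ≡⟨ cong (4 *_) (^-distribˡ-+-* 2 (suc τ) (suc τ)) ⟨
    4 * 2 ^ (suc τ + suc τ)           ≡⟨ ^-distribˡ-+-* 2 2 (suc τ + suc τ) ⟨
    2 ^ (2 + (suc τ + suc τ))         ∎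
    where open ≤-Reasoning

  suc≤tests : ∀ τ → suc τ ≤ tests τ
  suc≤tests τ = m≤m*n (suc τ) (suc τ)

  tests≤rounds : ∀ τ → tests τ ≤ rounds τ
  tests≤rounds τ = ≤-trans (m≤n*m (tests τ) 10) (m≤m*n (step τ) (2 + (suc τ + suc τ)))

-- With a′ / b′ = a / b + 1 / v, the ratio of a′ / b′ to a / b is at least 1 + 1 / v.
doubling : ∀ T a b v r → 0 < v → a ≤ b → T ≤ 2 ^ r →
           T * (a * (v * b)) ^ (v * r) ≤ ((v * a + b) * b) ^ (v * r)
doubling T a b v r v>0 a≤b T≤2^r = begin
  T * (a * (v * b)) ^ k           ≡⟨ cong (λ t → T * t ^ k) (exchange a v b) ⟩
  T * (v * (a * b)) ^ k           ≡⟨ cong (T *_) (^-distribʳ-* k v (a * b)) ⟩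
  T * (v ^ k * (a * b) ^ k)       ≡⟨ *-assoc T (v ^ k) ((a * b) ^ k) ⟨
  T * v ^ k * (a * b) ^ k         ≤⟨ *-monoˡ-≤ ((a * b) ^ k) (*-monoˡ-≤ (v ^ k) T≤2^r) ⟩
  2 ^ r * v ^ k * (a * b) ^ k     ≤⟨ *-monoˡ-≤ ((a * b) ^ k) (ratio-power v (suc v) v r v>0 (≤-reflexive (*-comm (suc v) v))) ⟩
  suc v ^ k * (a * b) ^ k         ≡⟨ ^-distribʳ-* k (suc v) (a * b) ⟨
  (suc v * (a * b)) ^ k           ≤⟨ ^-monoˡ-≤ k increase ⟩
  ((v * a + b) * b) ^ k           ∎
  where
  open ≤-Reasoning
  k = v * r
  exchange : ∀ a v b → a * (v * b) ≡ v * (a * b)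
  exchange = solve-∀
  increase : suc v * (a * b) ≤ (v * a + b) * b
  increase = begin
    a * b + v * (a * b)     ≤⟨ +-monoˡ-≤ _ (*-monoˡ-≤ b a≤b) ⟩
    b * b + v * (a * b)     ≡⟨ collect v a b ⟩
    (v * a + b) * b         ∎
    where
    collect : ∀ v a b → b * b + v * (a * b) ≡ (v * a + b) * b
    collect = solve-∀

gap-power : ∀ τ → num τ ≤ den τ →
            4 * tests τ * (num τ * den (suc τ)) ^ rounds τ ≤ (num (suc τ) * den τ) ^ rounds τ
gap-power τ a≤b rewrite rounds≡ τ = doubling (4 * tests τ) (num τ) (den τ) (step τ) (2 + (suc τ + suc τ)) (s≤s z≤n) a≤b (4*tests≤ τ)

-- Divided by `den τ ^ rounds τ`, this is the union bound over all tests at the threshold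
-- `num τ / den τ`.
weight : ℕ → ℕ
weight τ = tests τ * num τ ^ rounds τ

-- By `gap-power` even four times the union bound is at most a power of the next threshold, which is
-- at most 1. So 1 - 2δ is nonnegative.
2*weight≤ : ∀ τ → num (suc τ) ≤ den (suc τ) → weight τ + weight τ ≤ den τ ^ rounds τ
2*weight≤ τ a′≤b′ = *-cancelʳ-≤ _ _ (b′ ^ k) {{m^n≢0 b′ k {{>-nonZero (den>0 (suc τ))}}}} (begin
  (tests τ * a ^ k + tests τ * a ^ k) * b′ ^ k    ≤⟨ *-monoˡ-≤ (b′ ^ k) (m≤m+n (tests τ * a ^ k + tests τ * a ^ k) (tests τ * a ^ k + tests τ * a ^ k)) ⟩
  (tests τ * a ^ k + tests τ * a ^ k + (tests τ * a ^ k + tests τ * a ^ k)) * b′ ^ k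
    ≡⟨ collect (tests τ) (a ^ k) (b′ ^ k) ⟩
  4 * tests τ * (a ^ k * b′ ^ k)                  ≡⟨ cong (4 * tests τ *_) (^-distribʳ-* k a b′) ⟨
  4 * tests τ * (a * b′) ^ k                      ≤⟨ gap-power τ (num≤den-pred τ a′≤b′) ⟩
  (a′ * b) ^ k                                    ≤⟨ ^-monoˡ-≤ k (*-monoˡ-≤ b a′≤b′) ⟩
  (b′ * b) ^ k                                    ≡⟨ cong (_^ k) (*-comm b′ b) ⟩
  (b * b′) ^ k                                    ≡⟨ ^-distribʳ-* k b b′ ⟩
  b ^ k * b′ ^ k                                  ∎)
  where
  open ≤-Reasoning
  a = num τ
  b = den τ
  a′ = num (suc τ)
  b′ = den (suc τ)
  k = rounds τ
  collect : ∀ t e w → (t * e + t * e + (t * e + t * e)) * w ≡ 4 * t * (e * w)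
  collect = solve-∀

weight>0 : ∀ τ → 0 < weight τ
weight>0 τ = *-mono-≤ (tests>0 τ) (m^n>0 (num τ) {{>-nonZero (num>0 τ)}} (rounds τ))

-- The threshold is at least 1/2, so the inverse of the union bound is at most 2 ^ rounds. This
-- supplies u in `planted-pair`.
den^≤weight : ∀ τ → den τ ^ rounds τ ≤ 2 ^ rounds τ * weight τ
den^≤weight τ = begin
  den τ ^ k                   ≤⟨ ^-monoˡ-≤ k (den≤2num τ) ⟩
  (2 * num τ) ^ k             ≡⟨ ^-distribʳ-* k 2 (num τ) ⟩
  2 ^ k * num τ ^ k           ≤⟨ *-monoʳ-≤ (2 ^ k) (m≤n*m (num τ ^ k) (tests τ) {{>-nonZero (tests>0 τ)}}) ⟩
  2 ^ k * weight τ            ∎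
  where
  open ≤-Reasoning
  k = rounds τ

N≡2^ : ∀ C τ → N C τ ≡ 2 ^ (C * 4 ^ τ)
N≡2^ C zero    = cong (2 ^_) (sym (*-identityʳ C))
N≡2^ C (suc τ) = begin
  N C τ ^ 4                  ≡⟨ cong (_^ 4) (N≡2^ C τ) ⟩
  (2 ^ (C * 4 ^ τ)) ^ 4      ≡⟨ ^-*-assoc 2 (C * 4 ^ τ) 4 ⟩
  2 ^ (C * 4 ^ τ * 4)        ≡⟨ cong (2 ^_) (trans (*-assoc C (4 ^ τ) 4) (cong (C *_) (*-comm (4 ^ τ) 4))) ⟩
  2 ^ (C * 4 ^ suc τ)        ∎
  where open ≡-Reasoning

-- The cube grows by a factor of at most 27/8 < 4 from one τ to the next. It compares `rounds`,
-- which is cubic, with the logarithm C * 4 ^ τ of `N C τ`.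
cube≤ : ∀ τ → (τ + 2) * ((τ + 2) * (τ + 2)) ≤ 8 * 4 ^ τ
cube≤ zero    = ≤-refl
cube≤ (suc τ) = begin
  (suc τ + 2) * ((suc τ + 2) * (suc τ + 2))
    ≤⟨ m≤m+n _ (3 * (τ * τ * τ) + 15 * (τ * τ) + 21 * τ + 5) ⟩
  (suc τ + 2) * ((suc τ + 2) * (suc τ + 2)) + (3 * (τ * τ * τ) + 15 * (τ * τ) + 21 * τ + 5)
    ≡⟨ expand τ ⟩
  4 * ((τ + 2) * ((τ + 2) * (τ + 2)))
    ≤⟨ *-monoʳ-≤ 4 (cube≤ τ) ⟩
  4 * (8 * 4 ^ τ)
    ≡⟨ exchange (4 ^ τ) ⟩
  8 * 4 ^ suc τ ∎
  where
  open ≤-Reasoning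
  expand : ∀ τ → (suc τ + 2) * ((suc τ + 2) * (suc τ + 2)) + (3 * (τ * τ * τ) + 15 * (τ * τ) + 21 * τ + 5)
                 ≡ 4 * ((τ + 2) * ((τ + 2) * (τ + 2)))
  expand = solve-∀
  exchange : ∀ w → 4 * (8 * w) ≡ 8 * (4 * w)
  exchange = solve-∀

module Size (C : ℕ) (160≤C : 160 ≤ C) where

  -- `rounds τ` is 20 (τ + 1)² (τ + 2), hence at most 20 (τ + 2)³ ≤ 20 * 8 * 4 ^ τ. This is where
  -- 160 comes from.
  2^rounds≤N : ∀ τ → 2 ^ rounds τ ≤ N C τ
  2^rounds≤N τ = ≤-trans (^-monoʳ-≤ 2 rounds≤) (≤-reflexive (sym (N≡2^ C τ)))
    where
    open ≤-Reasoning
    expand : ∀ τ → 10 * (suc τ * suc τ) * (2 + (suc τ + suc τ)) + (20 * (τ + 2) * (2 * τ + 3))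
                   ≡ 20 * ((τ + 2) * ((τ + 2) * (τ + 2)))
    expand = solve-∀
    rounds≤ : rounds τ ≤ C * 4 ^ τ
    rounds≤ = begin
      rounds τ                                    ≡⟨ rounds≡ τ ⟩
      step τ * (2 + (suc τ + suc τ))              ≤⟨ m≤m+n _ (20 * (τ + 2) * (2 * τ + 3)) ⟩
      step τ * (2 + (suc τ + suc τ)) + 20 * (τ + 2) * (2 * τ + 3) ≡⟨ expand τ ⟩
      20 * ((τ + 2) * ((τ + 2) * (τ + 2)))        ≤⟨ *-monoʳ-≤ 20 (cube≤ τ) ⟩
      20 * (8 * 4 ^ τ)                            ≡⟨ *-assoc 20 8 (4 ^ τ) ⟨
      160 * 4 ^ τ                                 ≤⟨ *-monoˡ-≤ (4 ^ τ) 160≤C ⟩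
      C * 4 ^ τ                                   ∎

  128≤N : ∀ τ → 128 ≤ N C τ
  128≤N τ = ≤-trans (^-monoʳ-≤ 2 {7} {C * 4 ^ τ} (≤-trans (≤-trans (m≤m+n 7 153) 160≤C) (m≤m*n C (4 ^ τ) {{m^n≢0 4 τ}})))
                    (≤-reflexive (sym (N≡2^ C τ)))

  rounds<N : ∀ τ → rounds τ < N C τ
  rounds<N τ = <-≤-trans (n<2^n (rounds τ)) (2^rounds≤N τ)

  tests≤N : ∀ τ → tests τ ≤ N C τ
  tests≤N τ = ≤-trans (tests≤rounds τ) (<⇒≤ (rounds<N τ))

  suc≤N : ∀ τ → suc τ ≤ N C τ
  suc≤N τ = ≤-trans (suc≤tests τ) (tests≤N τ)

  N-mono : ∀ {i τ} → i ≤ τ → N C i ≤ N C τ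
  N-mono {i} {τ} i≤τ = subst₂ _≤_ (sym (N≡2^ C i)) (sym (N≡2^ C τ))
    (^-monoʳ-≤ 2 (*-monoʳ-≤ C (^-monoʳ-≤ 4 i≤τ)))

-- The base-2 logarithm of the number of inputs one player can have in the first τ instances: n ^ 99
-- letters of n * n bits for each n.
codeBits : ℕ → ℕ → ℕ
codeBits C zero    = 0
codeBits C (suc τ) = codeBits C τ + N C τ * N C τ * N C τ ^ 99

-- Estimates of exponents by powers of n

module Powers (n : ℕ) (128≤n : 128 ≤ n) where

  instance
    n≢0 : NonZero n
    n≢0 = >-nonZero (≤-trans (s≤s z≤n) 128≤n)

  4≤n : 4 ≤ n
  4≤n = ≤-trans (m≤m+n 4 124) 128≤n

  mono : ∀ a d → n ^ a ≤ n ^ (a + d)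
  mono a d = ^-monoʳ-≤ n (m≤m+n a d)

  -- The exponents below are all arranged as four summands, which one more factor n ≥ 4 absorbs.
  four-terms : ∀ a {w x y z} → w ≤ n ^ a → x ≤ n ^ a → y ≤ n ^ a → z ≤ n ^ a → w + x + y + z ≤ n ^ suc a
  four-terms a {w} {x} {y} {z} w≤ x≤ y≤ z≤ = begin
    w + x + y + z                        ≤⟨ +-mono-≤ (+-mono-≤ (+-mono-≤ w≤ x≤) y≤) z≤ ⟩
    n ^ a + n ^ a + n ^ a + n ^ a        ≡⟨ four (n ^ a) ⟩
    4 * n ^ a                            ≤⟨ *-monoˡ-≤ (n ^ a) 4≤n ⟩
    n ^ suc a                            ∎
    where
    open ≤-Reasoning
    four : ∀ w → w + w + w + w ≡ 4 * w
    four = solve-∀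

  2^-mono : ∀ {a b} → a ≤ b → 2 ^ a ≤ 2 ^ b
  2^-mono = ^-monoʳ-≤ 2

  n*n≡n^2 : n * n ≡ n ^ 2
  n*n≡n^2 = cong (n *_) (sym (*-identityʳ n))

  n^99≤2^ : n ^ 99 ≤ 2 ^ n ^ 2
  n^99≤2^ = begin
    n ^ 99              ≤⟨ ^-monoˡ-≤ 99 (<⇒≤ (n<2^n n)) ⟩
    (2 ^ n) ^ 99        ≡⟨ ^-*-assoc 2 n 99 ⟩
    2 ^ (n * 99)        ≤⟨ 2^-mono (*-monoʳ-≤ n (≤-trans (m≤m+n 99 29) 128≤n)) ⟩
    2 ^ (n * n)         ≡⟨ cong (2 ^_) n*n≡n^2 ⟩
    2 ^ n ^ 2           ∎
    where open ≤-Reasoning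

  colours<  : ∀ e → e ≤ n ^ 26 → 2 ^ e * (2 ^ e * 2 ^ (n * n)) < 2 ^ n ^ 27
  colours< e e≤ = begin-strict
    2 ^ e * (2 ^ e * 2 ^ (n * n))       ≡⟨ cong (2 ^ e *_) (^-distribˡ-+-* 2 e (n * n)) ⟨
    2 ^ e * 2 ^ (e + n * n)             ≡⟨ ^-distribˡ-+-* 2 e (e + n * n) ⟨
    2 ^ (e + (e + n * n))               <⟨ ^-monoʳ-< 2 ≤-refl (m<m+n (e + (e + n * n)) {1} (s≤s z≤n)) ⟩
    2 ^ (e + (e + n * n) + 1)           ≡⟨ cong (λ t → 2 ^ (t + 1)) (+-assoc e e (n * n)) ⟨
    2 ^ (e + e + n * n + 1)             ≤⟨ 2^-mono (four-terms 26 e≤ e≤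
                                              (≤-trans (≤-reflexive n*n≡n^2) (mono 2 24)) (mono 0 26)) ⟩
    2 ^ n ^ 27                          ∎
    where open ≤-Reasoning

  -- Fixes L = n ^ 28: so many doublings outweigh the number of colours and the squared loss of the
  -- corruption bound.
  letters-gap : 2 * 2 ^ n ^ 27 * (2 * (n ^ 99 * 2 ^ (n * n)) * (2 * (n ^ 99 * 2 ^ (n * n)))) ≤ 2 ^ n ^ 28
  letters-gap = begin
    2 * 2 ^ n ^ 27 * (2 * (n ^ 99 * 2 ^ (n * n)) * (2 * (n ^ 99 * 2 ^ (n * n))))
      ≤⟨ *-monoʳ-≤ (2 * 2 ^ n ^ 27) (*-mono-≤ c≤ c≤) ⟩
    2 * 2 ^ n ^ 27 * (2 ^ (1 + (n ^ 2 + n ^ 2)) * 2 ^ (1 + (n ^ 2 + n ^ 2)))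
      ≡⟨ cong (2 * 2 ^ n ^ 27 *_) (^-distribˡ-+-* 2 (1 + (n ^ 2 + n ^ 2)) (1 + (n ^ 2 + n ^ 2))) ⟨
    2 ^ (1 + n ^ 27) * 2 ^ (1 + (n ^ 2 + n ^ 2) + (1 + (n ^ 2 + n ^ 2)))
      ≡⟨ ^-distribˡ-+-* 2 (1 + n ^ 27) _ ⟨
    2 ^ (1 + n ^ 27 + (1 + (n ^ 2 + n ^ 2) + (1 + (n ^ 2 + n ^ 2))))
      ≡⟨ cong (2 ^_) (regroup (n ^ 27) (n ^ 2)) ⟩
    2 ^ (3 + n ^ 27 + (n ^ 2 + n ^ 2) + (n ^ 2 + n ^ 2))
      ≤⟨ 2^-mono (four-terms 27 (≤-trans (≤-trans (m≤m+n 3 1) 4≤n) (≤-trans (≤-reflexive (sym (*-identityʳ n))) (mono 1 26))) ≤-refl twice twice) ⟩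
    2 ^ n ^ 28 ∎
    where
    open ≤-Reasoning
    regroup : ∀ a b → 1 + a + (1 + (b + b) + (1 + (b + b))) ≡ 3 + a + (b + b) + (b + b)
    regroup = solve-∀
    twice : n ^ 2 + n ^ 2 ≤ n ^ 27
    twice = begin
      n ^ 2 + n ^ 2      ≡⟨ cong (n ^ 2 +_) (+-identityʳ (n ^ 2)) ⟨
      2 * n ^ 2          ≤⟨ *-monoˡ-≤ (n ^ 2) (≤-trans (m≤m+n 2 2) 4≤n) ⟩
      n ^ 3              ≤⟨ mono 3 24 ⟩
      n ^ 27             ∎
    c≤ : 2 * (n ^ 99 * 2 ^ (n * n)) ≤ 2 ^ (1 + (n ^ 2 + n ^ 2))
    c≤ = *-monoʳ-≤ 2 (begin
      n ^ 99 * 2 ^ (n * n)        ≤⟨ *-mono-≤ n^99≤2^ (≤-reflexive (cong (2 ^_) n*n≡n^2)) ⟩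
      2 ^ n ^ 2 * 2 ^ n ^ 2       ≡⟨ ^-distribˡ-+-* 2 (n ^ 2) (n ^ 2) ⟨
      2 ^ (n ^ 2 + n ^ 2)         ∎)

  -- The exponent multiplies n ^ 4 + 1 per run, k + 1 runs per test, T tests and 2 ^ k * n ^ 28
  -- repetitions, at most n ^ 36 in all. The number n ^ 99 of letters leaves ample room.
  rectangles-small : ∀ k T → 2 ^ k ≤ n → suc k ≤ n → T ≤ n →
    8 * 2 ^ n ^ 27 * (((2 ^ n ^ 4 + 2 ^ n ^ 4) ^ suc k) ^ T) ^ (2 ^ k * n ^ 28) * 2 ^ (2 ^ k * n ^ 28) ≤ 4 ^ n ^ 99
  rectangles-small k T 2^k≤n k<n T≤n = begin
    8 * 2 ^ n ^ 27 * (((2 ^ n ^ 4 + 2 ^ n ^ 4) ^ suc k) ^ T) ^ K * 2 ^ K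
      ≡⟨ cong (λ t → 8 * 2 ^ n ^ 27 * ((t ^ suc k) ^ T) ^ K * 2 ^ K) (cong (2 ^ n ^ 4 +_) (+-identityʳ (2 ^ n ^ 4))) ⟨
    8 * 2 ^ n ^ 27 * (((2 ^ suc (n ^ 4)) ^ suc k) ^ T) ^ K * 2 ^ K
      ≡⟨ cong (λ t → 8 * 2 ^ n ^ 27 * t * 2 ^ K) flatten ⟩
    2 ^ 3 * 2 ^ n ^ 27 * 2 ^ R * 2 ^ K
      ≡⟨ cong (λ t → t * 2 ^ R * 2 ^ K) (^-distribˡ-+-* 2 3 (n ^ 27)) ⟨
    2 ^ (3 + n ^ 27) * 2 ^ R * 2 ^ K
      ≡⟨ cong (_* 2 ^ K) (^-distribˡ-+-* 2 (3 + n ^ 27) R) ⟨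
    2 ^ (3 + n ^ 27 + R) * 2 ^ K
      ≡⟨ ^-distribˡ-+-* 2 (3 + n ^ 27 + R) K ⟨
    2 ^ (3 + n ^ 27 + R + K)
      ≤⟨ 2^-mono (four-terms 36 (≤-trans (≤-trans (m≤m+n 3 1) 4≤n) (≤-trans (≤-reflexive (sym (*-identityʳ n))) (mono 1 35)))
                    (mono 27 9) R≤ (≤-trans K≤ (mono 29 7))) ⟩
    2 ^ n ^ 37
      ≤⟨ 2^-mono (mono 37 62) ⟩
    2 ^ n ^ 99
      ≤⟨ ^-monoˡ-≤ (n ^ 99) (s≤s (s≤s z≤n)) ⟩
    4 ^ n ^ 99 ∎
    where
    open ≤-Reasoning
    K = 2 ^ k * n ^ 28
    R = suc (n ^ 4) * suc k * T * K
    flatten : (((2 ^ suc (n ^ 4)) ^ suc k) ^ T) ^ K ≡ 2 ^ R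
    flatten = begin-equality
      (((2 ^ suc (n ^ 4)) ^ suc k) ^ T) ^ K    ≡⟨ cong (λ t → (t ^ T) ^ K) (^-*-assoc 2 (suc (n ^ 4)) (suc k)) ⟩
      ((2 ^ (suc (n ^ 4) * suc k)) ^ T) ^ K    ≡⟨ cong (_^ K) (^-*-assoc 2 (suc (n ^ 4) * suc k) T) ⟩
      (2 ^ (suc (n ^ 4) * suc k * T)) ^ K      ≡⟨ ^-*-assoc 2 (suc (n ^ 4) * suc k * T) K ⟩
      2 ^ R                                    ∎
    K≤ : K ≤ n ^ 29
    K≤ = *-monoˡ-≤ (n ^ 28) 2^k≤n
    suc-n^4≤ : suc (n ^ 4) ≤ n ^ 5
    suc-n^4≤ = begin
      1 + n ^ 4          ≤⟨ +-monoˡ-≤ (n ^ 4) (mono 0 4) ⟩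
      n ^ 4 + n ^ 4      ≡⟨ cong (n ^ 4 +_) (+-identityʳ (n ^ 4)) ⟨
      2 * n ^ 4          ≤⟨ *-monoˡ-≤ (n ^ 4) (≤-trans (m≤m+n 2 2) 4≤n) ⟩
      n ^ 5              ∎
    R≤ : R ≤ n ^ 36
    R≤ = begin
      suc (n ^ 4) * suc k * T * K        ≤⟨ *-mono-≤ (*-mono-≤ (*-mono-≤ suc-n^4≤ k<n) T≤n) K≤ ⟩
      n ^ 5 * n * n * n ^ 29             ≡⟨ cong (_* n ^ 29) (gather (n ^ 5) n) ⟩
      n ^ 7 * n ^ 29                     ≡⟨ ^-distribˡ-+-* n 7 29 ⟨
      n ^ 36                             ∎
      where
      gather : ∀ w n → w * n * n ≡ n * (n * w)
      gather = solve-∀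

-- An instance takes n ^ 101 bits, and passing to n ^ 4 leaves n ^ 104 = (n ^ 4) ^ 26 for it and all
-- earlier ones. So the colours are few compared with 4 ^ (n ^ 99).
codeBits≤ : ∀ C → 160 ≤ C → ∀ τ → codeBits C τ ≤ N C τ ^ 26
codeBits≤ C 160≤C zero    = z≤n
codeBits≤ C 160≤C (suc τ) = begin
  codeBits C τ + n * n * n ^ 99    ≤⟨ +-monoˡ-≤ (n * n * n ^ 99) (≤-trans (codeBits≤ C 160≤C τ) (mono 26 75)) ⟩
  n ^ 101 + n * n * n ^ 99         ≡⟨ cong (n ^ 101 +_) (*-assoc n n (n ^ 99)) ⟩
  n ^ 101 + n ^ 101                ≡⟨ cong (n ^ 101 +_) (+-identityʳ (n ^ 101)) ⟨
  2 * n ^ 101                      ≤⟨ *-monoˡ-≤ (n ^ 101) (≤-trans (m≤m+n 2 2) 4≤n) ⟩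
  n ^ 102                          ≤⟨ mono 102 2 ⟩
  n ^ 104                          ≡⟨ ^-*-assoc n 4 26 ⟨
  (n ^ 4) ^ 26                     ∎
  where
  open ≤-Reasoning
  n = N C τ
  open Powers n (Size.128≤N C 160≤C τ)

-- The induction

-- The n ^ 100 strings of an instance are cut into n ^ 99 blocks of n strings. A block has a place
-- for each string to be planted, since τ + 1 ≤ n.
Letter Word : ℕ → Set
Letter n = Vec (BitString n) n
Word n   = Vec (Letter n) (n ^ 99)

letters : ∀ n → List (Letter n)
letters n = vecs (vecs booleans n) n

words : ∀ n → List (Word n)
words n = vecs (letters n) (n ^ 99)

∈-letters : ∀ {n} (σ : Letter n) → σ ∈ letters n
∈-letters = ∈-vecs (∈-vecs ∈-booleans)

length-letters : ∀ n → length (letters n) ≡ 2 ^ (n * n)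
length-letters n = trans (length-vecs (vecs booleans n) n)
  (trans (cong (_^ n) (length-vecs booleans n)) (^-*-assoc 2 n n))

shift : ∀ {n} → Letter n → Letter n → Letter n
shift σ z = zipWith _⊕_ z σ

shift-invariant : ∀ {n} (σ : Letter n) → Invariant (letters n) (shift σ)
shift-invariant {n} = zipWith-invariant (vecs booleans n) _⊕_ (zipWith-invariant booleans _xor_ xor-invariant)

-- String i of block a goes to position `combine i a`; n ^ 100 unfolds to n * n ^ 99, which is what
-- `remQuot` divides.
spread : ∀ {n} → Word n → Vec (BitString n) (n ^ 100)
spread {n} w = tabulate (λ c → lookup (lookup w (proj₂ (remQuot {n} (n ^ 99) c))) (proj₁ (remQuot {n} (n ^ 99) c)))

lookup-spread : ∀ {n} (w : Word n) i a → lookup (spread w) (combine i a) ≡ lookup (lookup w a) i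
lookup-spread {n} w i a = trans (lookup∘tabulate _ (combine i a))
  (cong (λ (i , a) → lookup (lookup w a) i) (remQuot-combine {n} i a))

-- Equal positions in the planted block have xor `lookup σ i`, as the string of x cancels. One hit
-- thus spoils all n strings of σ at once.
planted-hit : ∀ {n} (x y : Word n) (σ : Letter n) a i → lookup y a ≡ shift σ (lookup x a) →
              ¬ IsSolution (lookup σ i) (spread x) (spread y)
planted-hit x y σ a i eq sol = sol (combine i a) (combine i a) (sym (begin
  lookup (spread x) (combine i a) ⊕ lookup (spread y) (combine i a)
    ≡⟨ cong₂ _⊕_ (lookup-spread x i a) (lookup-spread y i a) ⟩
  xᵢ ⊕ lookup (lookup y a) i
    ≡⟨ cong (λ z → xᵢ ⊕ lookup z i) eq ⟩
  xᵢ ⊕ lookup (shift σ (lookup x a)) i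
    ≡⟨ cong (xᵢ ⊕_) (lookup-zipWith _⊕_ i (lookup x a) σ) ⟩
  xᵢ ⊕ (xᵢ ⊕ lookup σ i)
    ≡⟨ ⊕-cancelˡ xᵢ (lookup σ i) ⟩
  lookup σ i ∎))
  where
  open ≡-Reasoning
  xᵢ = lookup (lookup x a) i

IsSolution? : ∀ {n m} (s : BitString n) (X Y : Vec (BitString n) m) → Dec (IsSolution s X Y)
IsSolution? s X Y = all? (λ a → all? (λ b → ¬? (s ≟S (lookup X a ⊕ lookup Y b))))

not-does : ∀ {P : Set} (P? : Dec P) → not (does P?) ≡ true → ¬ P
not-does (no ¬p) _ = ¬p

every-cartesian : ∀ {I J A : Set} (f : I → J → A) is js (Q : A → Set) → (∀ i j → Q (f i j)) →
                  ∀ a → a ∈ cartesianProductWith f is js → Q a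
every-cartesian f is js Q q a a∈ with ∈-cartesianProductWith⁻ f is js a∈
... | i , j , _ , _ , refl = q i j

every-map : ∀ {I A : Set} (f : I → A) is (Q : A → Set) → (∀ i → Q (f i)) → ∀ a → a ∈ map f is → Q a
every-map f is Q q a a∈ with ∈-map⁻ f a∈
... | i , _ , refl = q i

module Hardness (C : ℕ) (160≤C : 160 ≤ C) where

  open Size C 160≤C

  Code : ℕ → Set
  Code zero    = ⊤
  Code (suc τ) = Code τ × Word (N C τ)

  codes : ∀ τ → List (Code τ)
  codes zero    = tt ∷ []
  codes (suc τ) = cartesianProductWith _,_ (codes τ) (words (N C τ))

  ∈-codes : ∀ τ (w : Code τ) → w ∈ codes τ
  ∈-codes zero    tt      = here refl
  ∈-codes (suc τ) (w , x) = ∈-cartesianProductWith⁺ _,_ (∈-codes τ w) (∈-vecs ∈-letters x)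

  length-codes : ∀ τ → length (codes τ) ≡ 2 ^ codeBits C τ
  length-codes zero    = refl
  length-codes (suc τ) = begin
    length (codes (suc τ))                              ≡⟨ length-cartesian _,_ (codes τ) (words n) ⟩
    length (codes τ) * length (words n)                 ≡⟨ cong₂ _*_ (length-codes τ) (length-vecs (letters n) (n ^ 99)) ⟩
    2 ^ codeBits C τ * length (letters n) ^ (n ^ 99)    ≡⟨ cong (λ l → 2 ^ codeBits C τ * l ^ (n ^ 99)) (length-letters n) ⟩
    2 ^ codeBits C τ * (2 ^ (n * n)) ^ (n ^ 99)         ≡⟨ cong (2 ^ codeBits C τ *_) (^-*-assoc 2 (n * n) (n ^ 99)) ⟩
    2 ^ codeBits C τ * 2 ^ (n * n * n ^ 99)             ≡⟨ ^-distribˡ-+-* 2 (codeBits C τ) (n * n * n ^ 99) ⟨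
    2 ^ codeBits C (suc τ)                              ∎
    where
    open ≡-Reasoning
    n = N C τ

  -- Outside i < τ the block is junk.
  block : ∀ τ → Code τ → ∀ i → Word (N C i)
  block zero    _       i = replicate _ (replicate _ (replicate _ true))
  block (suc τ) (w , x) i with i ≟ τ
  ... | yes refl = x
  ... | no  _    = block τ w i

  block-last : ∀ τ (w : Code τ) x → block (suc τ) (w , x) τ ≡ x
  block-last τ w x with τ ≟ τ
  ... | yes refl = refl
  ... | no  τ≢τ  = contradiction refl τ≢τ

  block-init : ∀ τ (w : Code τ) x {i} → i < τ → block (suc τ) (w , x) i ≡ block τ w i
  block-init τ w x {i} i<τ with i ≟ τ
  ... | yes refl = contradiction refl (<⇒≢ i<τ)
  ... | no  _    = refl

  -- Indexing by all pairs of naturals makes restriction to fewer instances a mere `Family-comap`;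
  -- `Fooled` looks only at j ≤ i < τ.
  Families : ℕ → Set
  Families τ = ∀ i (j : ℕ) → Family (Code τ) (Code τ) (BitString (N C i)) (2 ^ N C i ^ 4)

  -- The contrapositive of the second alternative of `Conclusion`, at the threshold `num τ / den τ`.
  -- It bounds all solutions at once, so no likely output has to be named in the induction.
  Fooled : ∀ τ → Families τ → Code τ → Code τ → Set
  Fooled τ F w w′ = ∀ i j → i < τ → j ≤ i → ∀ s →
    IsSolution s (spread (block τ w i)) (spread (block τ w′ i)) →
    count (F i j) s w w′ * den τ ≤ num τ * seeds (F i j)

  restrict : ∀ {τ} → Families (suc τ) → Word (N C τ) → Word (N C τ) → Families τ
  restrict F x y i j = Family-comap (_, x) (_, y) (F i j)

  -- `ih` is demanded for every `x` and `y` because the codes it returns vary with the last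
  -- instance. `a′≤b′` is what makes `2*weight≤` available.
  module Step (τ : ℕ) (F : Families (suc τ)) (ih : ∀ x y → ∃ λ w → ∃ λ w′ → Fooled τ (restrict F x y) w w′)
              (a′≤b′ : num (suc τ) ≤ den (suc τ)) where

    n k size₁ : ℕ
    n = N C τ
    k = rounds τ
    size₁ = (2 ^ n ^ 4 + 2 ^ n ^ 4) ^ suc k

    open Powers n (128≤N τ)

    Colour : Set
    Colour = Code τ × Code τ × Letter n

    colours : List Colour
    colours = cartesianProductWith _,_ (codes τ) (cartesianProductWith _,_ (codes τ) (letters n))

    length-colours : length colours < 2 ^ n ^ 27
    length-colours = ≤-trans (s≤s (≤-reflexive |colours|)) (colours< (codeBits C τ) (codeBits≤ C 160≤C τ))
      where
      |colours| : length colours ≡ 2 ^ codeBits C τ * (2 ^ codeBits C τ * 2 ^ (n * n))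
      |colours| = trans (length-cartesian _,_ (codes τ) _) (cong₂ _*_ (length-codes τ)
        (trans (length-cartesian _,_ (codes τ) (letters n)) (cong₂ _*_ (length-codes τ) (length-letters n))))

    -- Budgets increase with i, so after weakening all tests share one size.
    fix : Code τ → Code τ → ∀ i (j : ℕ) → i ≤ τ → Family (Word n) (Word n) (BitString (N C i)) (2 ^ n ^ 4)
    fix w w′ i j i≤τ = Family-weaken (2^-mono (^-monoˡ-≤ 4 (N-mono i≤τ))) (Family-comap (w ,_) (w′ ,_) (F i j))

    count-fix : ∀ w w′ i j i≤τ s x y → count (fix w w′ i j i≤τ) s x y ≡ count (F i j) s (w , x) (w′ , y)
    count-fix w w′ i j i≤τ s x y = count-comap (w ,_) (w′ ,_) (F i j) s x y

    solves : Code τ → Code τ → ∀ i → BitString (N C i) → Bool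
    solves w w′ i s = does (IsSolution? s (spread (block τ w i)) (spread (block τ w′ i)))

    slot : Fin (suc τ) → Fin n
    slot j = inject≤ j (suc≤N τ)

    differs : Letter n → Fin (suc τ) → BitString n → Bool
    differs σ j s = not (does (s ≟S lookup σ (slot j)))

    -- For j > i the cut-off repeats the test of (i , i).
    lowerTest : Colour → Fin τ → Fin (suc τ) → Test (Word n) (Word n) size₁
    lowerTest (w , w′ , σ) i j = test (fix w w′ (toℕ i) (toℕ j ⊓ toℕ i) (<⇒≤ (toℕ<n i))) (solves w w′ (toℕ i)) k

    topTest : Colour → Fin (suc τ) → Test (Word n) (Word n) size₁
    topTest (w , w′ , σ) j = test (fix w w′ τ (toℕ j) ≤-refl) (differs σ j) k

    testList : Colour → List (Test (Word n) (Word n) size₁)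
    testList c = cartesianProductWith (lowerTest c) (allFin τ) (allFin (suc τ)) ++ map (topTest c) (allFin (suc τ))

    length-testList : ∀ c → length (testList c) ≡ tests τ
    length-testList c = begin
      length (testList c)
        ≡⟨ length-++ (cartesianProductWith (lowerTest c) (allFin τ) (allFin (suc τ))) ⟩
      length (cartesianProductWith (lowerTest c) (allFin τ) (allFin (suc τ))) + length (map (topTest c) (allFin (suc τ)))
        ≡⟨ cong₂ _+_ (trans (length-cartesian (lowerTest c) (allFin τ) (allFin (suc τ))) (cong₂ _*_ (|allFin| τ) (|allFin| (suc τ))))
                     (trans (length-map (topTest c) (allFin (suc τ))) (|allFin| (suc τ))) ⟩
      τ * suc τ + suc τ
        ≡⟨ tests≡ τ ⟨
      tests τ ∎
      where
      open ≡-Reasoning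
      |allFin| : ∀ m → length (allFin m) ≡ m
      |allFin| m = length-tabulate {n = m} (λ i → i)

    size₁>0 : 0 < size₁
    size₁>0 = m^n>0 (2 ^ n ^ 4 + 2 ^ n ^ 4) {{>-nonZero (≤-trans (m^n>0 2 (n ^ 4)) (m≤m+n _ _))}} (suc k)

    combined : Colour → Test (Word n) (Word n) (size₁ ^ tests τ)
    combined c = conjunction size₁>0 (tests τ) (testList c) (≤-reflexive (length-testList c))

    -- `majority` applies as thresholds are at least 1/2. A letter has n slots for τ + 1 protocols;
    -- the other slots are filled from the families `F τ j` with larger j.
    popularStrings : ∀ w w′ x y → ∃ λ (σ : Letter n) → ∀ j s → differs σ j s ≡ true →
                     count (fix w w′ τ (toℕ j) ≤-refl) s x y * den τ ≤ num τ * seeds (F τ (toℕ j))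
    popularStrings w w′ x y = σ , λ j s s≢ → proj₂ (top (toℕ j)) s (λ s≡ → not-does (s ≟S _) s≢ (trans s≡ (sym (σ≡ j))))
      where
      top : ∀ j → _
      top j = majority (fix w w′ τ j ≤-refl) (num τ) (den τ) x y (den≤2num τ) (replicate n true) (∈-vecs ∈-booleans)
      σ : Letter n
      σ = tabulate (λ j → proj₁ (top (toℕ j)))
      σ≡ : ∀ j → lookup σ (slot j) ≡ proj₁ (top (toℕ j))
      σ≡ j = trans (lookup∘tabulate _ (slot j)) (cong (λ j → proj₁ (top j)) (toℕ-inject≤ j (suc≤N τ)))

    Low : Word n → Word n → ∀ {s} → Test (Word n) (Word n) s → Set
    Low x y t = runs t * den τ ^ k ≤ passes t x y * den τ ^ k + num τ ^ k * runs t

    module Colouring (x y : Word n) (w w′ : Code τ) (fooled : Fooled τ (restrict F x y) w w′) where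

      σ : Letter n
      σ = proj₁ (popularStrings w w′ x y)

      c : Colour
      c = w , w′ , σ

      c∈ : c ∈ colours
      c∈ = ∈-cartesianProductWith⁺ _,_ (∈-codes τ w) (∈-cartesianProductWith⁺ _,_ (∈-codes τ w′) (∈-letters σ))

      lower : ∀ i j → Low x y (lowerTest c i j)
      lower i j = test-low (fix w w′ i′ j′ i′≤τ) (solves w w′ i′) k (num τ) (den τ) x y
        (λ s sol → subst (λ c → c * den τ ≤ num τ * seeds (F i′ j′)) (sym (agree s))
          (fooled i′ j′ (toℕ<n i) (m⊓n≤n (toℕ j) i′) s
            (does-true (IsSolution? s (spread (block τ w i′)) (spread (block τ w′ i′))) sol)))
        where
        i′ = toℕ i
        j′ = toℕ j ⊓ toℕ i
        i′≤τ = <⇒≤ (toℕ<n i)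
        -- Fixing the earlier instances first or the last one first gives the same count.
        agree : ∀ s → count (fix w w′ i′ j′ i′≤τ) s x y ≡ count (restrict F x y i′ j′) s w w′
        agree s = trans (count-fix w w′ i′ j′ i′≤τ s x y) (sym (count-comap (_, x) (_, y) (F i′ j′) s w w′))

      top : ∀ j → Low x y (topTest c j)
      top j = test-low (fix w w′ τ (toℕ j) ≤-refl) (differs σ j) k (num τ) (den τ) x y (proj₂ (popularStrings w w′ x y) j)

      each : ∀ t → t ∈ testList c → Low x y t
      each t t∈ = [ every-cartesian (lowerTest c) (allFin τ) (allFin (suc τ)) (Low x y) lower t
                  , every-map (topTest c) (allFin (suc τ)) (Low x y) top t ]′
                  (∈-++⁻ (cartesianProductWith (lowerTest c) (allFin τ) (allFin (suc τ))) t∈)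

      all : allRuns (testList c) * den τ ^ k ≤ allPass (testList c) x y * den τ ^ k + tests τ * num τ ^ k * allRuns (testList c)
      all = subst (λ T → allRuns (testList c) * den τ ^ k ≤ allPass (testList c) x y * den τ ^ k + T * num τ ^ k * allRuns (testList c))
        (length-testList c) (allPass-low (testList c) (den τ ^ k) (num τ ^ k) x y each)

    low : ∀ x y → ∃ λ c → c ∈ colours ×
          allRuns (testList c) * den τ ^ k ≤ allPass (testList c) x y * den τ ^ k + weight τ * allRuns (testList c)
    low x y = c , c∈ , all
      where open Colouring x y (proj₁ (ih x y)) (proj₁ (proj₂ (ih x y))) (proj₂ (proj₂ (ih x y)))

    |letters|>0 : 1 ≤ n ^ 99 * length (letters n)
    |letters|>0 = *-mono-≤ (m^n>0 n 99) (subst (1 ≤_) (sym (length-letters n)) (m^n>0 2 (n * n)))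

    halfLetters : ∃ λ q → length (letters n) ≡ q + q
    halfLetters = 2 ^ pred (n * n) , (begin
      length (letters n)                              ≡⟨ length-letters n ⟩
      2 ^ (n * n)                                     ≡⟨ cong (2 ^_) (suc-pred (n * n) {{m*n≢0 n n}}) ⟨
      2 ^ suc (pred (n * n))                          ≡⟨ cong (2 ^ pred (n * n) +_) (+-identityʳ _) ⟩
      2 ^ pred (n * n) + 2 ^ pred (n * n)             ∎)
      where open ≡-Reasoning

    gap : 2 * 2 ^ n ^ 27 * (2 * (n ^ 99 * length (letters n)) * (2 * (n ^ 99 * length (letters n)))) ≤ 2 ^ n ^ 28
    gap = subst (λ l → 2 * 2 ^ n ^ 27 * (2 * (n ^ 99 * l) * (2 * (n ^ 99 * l))) ≤ 2 ^ n ^ 28)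
      (sym (length-letters n)) letters-gap

    module Planted (w w′ : Code τ) (σ : Letter n) (x y : Word n) (a : Fin (n ^ 99)) (hit : lookup y a ≡ shift σ (lookup x a))
      (pass : allRuns (testList (w , w′ , σ)) * den τ ^ k <
              allPass (testList (w , w′ , σ)) x y * den τ ^ k + 2 * weight τ * allRuns (testList (w , w′ , σ))) where

      c : Colour
      c = w , w′ , σ

      single : ∀ {O : Set} (_≟_ : DecidableEquality O) (G : Family (Word n) (Word n) O (2 ^ n ^ 4)) D →
               Counting.test _≟_ G D k ∈ testList c → ∀ s → D s ≡ true →
               Counting.count _≟_ G s x y * den (suc τ) ≤ num (suc τ) * seeds G
      single _≟_ G D t∈ = Counting.test-high _≟_ G D k (num τ) (den τ) (num (suc τ)) (den (suc τ)) (tests τ) x y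
        (den>0 (suc τ)) (den≤2num (suc τ)) (gap-power τ (num≤den-pred τ a′≤b′)) pass-one
        where
        pass-one : runs (Counting.test _≟_ G D k) * den τ ^ k <
                   passes (Counting.test _≟_ G D k) x y * den τ ^ k + 2 * weight τ * runs (Counting.test _≟_ G D k)
        pass-one = allPass-high (testList c) (den τ ^ k) (2 * weight τ) x y pass (Counting.test _≟_ G D k) t∈

      -- The proof of i ≤ τ is quantified so that i can be transported; the counts in `fix` do not
      -- depend on it.
      LowerBound : ℕ → ℕ → Set
      LowerBound i j = ∀ (i≤τ : i ≤ τ) s → solves w w′ i s ≡ true →
                       count (fix w w′ i j i≤τ) s x y * den (suc τ) ≤ num (suc τ) * seeds (F i j)

      lowerBound-Fin : ∀ i j → LowerBound (toℕ i) (toℕ j ⊓ toℕ i)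
      lowerBound-Fin i j _ = single _≟S_ (fix w w′ (toℕ i) (toℕ j ⊓ toℕ i) (<⇒≤ (toℕ<n i))) (solves w w′ (toℕ i))
        (∈-++⁺ˡ (∈-cartesianProductWith⁺ (lowerTest c) (∈-allFin i) (∈-allFin j)))

      lowerBound : ∀ {i j} → i < τ → j ≤ i → LowerBound i j
      -- Since j ≤ i, the cut-off in `lowerTest` returns j itself.
      lowerBound i<τ j≤i = subst₂ LowerBound (toℕ-fromℕ< i<τ)
        (trans (cong₂ _⊓_ (toℕ-fromℕ< j<1+τ) (toℕ-fromℕ< i<τ)) (m≤n⇒m⊓n≡m j≤i))
        (lowerBound-Fin (fromℕ< i<τ) (fromℕ< j<1+τ))
        where j<1+τ = ≤-<-trans j≤i (m<n⇒m<1+n i<τ)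

      TopBound : ℕ → Set
      TopBound j = ∀ s → IsSolution s (spread x) (spread y) →
                   count (fix w w′ τ j ≤-refl) s x y * den (suc τ) ≤ num (suc τ) * seeds (F τ j)

      topBound-Fin : ∀ j → TopBound (toℕ j)
      topBound-Fin j s sol = single _≟S_ (fix w w′ τ (toℕ j) ≤-refl) (differs σ j)
        (∈-++⁺ʳ (cartesianProductWith (lowerTest c) (allFin τ) (allFin (suc τ))) (∈-map⁺ (topTest c) (∈-allFin j)))
        -- A solution differs from the string planted in slot j, so the top test applies to it.
        s (cong not (dec-false (s ≟S lookup σ (slot j))
            (λ { refl → planted-hit x y σ a (slot j) hit sol })))

      topBound : ∀ {j} → j ≤ τ → TopBound j
      topBound j≤τ = subst TopBound (toℕ-fromℕ< (s≤s j≤τ)) (topBound-Fin (fromℕ< (s≤s j≤τ)))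

      FooledAt : ℕ → Set
      FooledAt i = ∀ j → j ≤ i → ∀ s →
        IsSolution s (spread (block (suc τ) (w , x) i)) (spread (block (suc τ) (w′ , y) i)) →
        count (F i j) s (w , x) (w′ , y) * den (suc τ) ≤ num (suc τ) * seeds (F i j)

      fooled-lower : ∀ {i} → i < τ → FooledAt i
      fooled-lower {i} i<τ j j≤i s sol = subst (λ c → c * den (suc τ) ≤ num (suc τ) * seeds (F i j))
        (count-fix w w′ i j (<⇒≤ i<τ) s x y)
        (lowerBound i<τ j≤i (<⇒≤ i<τ) s (dec-true (IsSolution? s (spread (block τ w i)) (spread (block τ w′ i)))
          (subst₂ (λ u v → IsSolution s (spread u) (spread v)) (block-init τ w x i<τ) (block-init τ w′ y i<τ) sol)))

      fooled-top : FooledAt τ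
      fooled-top j j≤τ s sol = subst (λ c → c * den (suc τ) ≤ num (suc τ) * seeds (F τ j))
        (count-fix w w′ τ j ≤-refl s x y)
        (topBound j≤τ s (subst₂ (λ u v → IsSolution s (spread u) (spread v)) (block-last τ w x) (block-last τ w′ y) sol))

      fooled : Fooled (suc τ) F (w , x) (w′ , y)
      fooled i j i<1+τ = [ fooled-lower , (λ i≡τ → subst FooledAt (sym i≡τ) fooled-top) ]′ (m≤n⇒m<n∨m≡n (≤-pred i<1+τ)) j

    remainder : ∃ λ e → weight τ + weight τ + e ≡ den τ ^ k
    remainder = m≤n⇒∃[o]m+o≡n (2*weight≤ τ a′≤b′)

    plantedPair : ∃ λ c → ∃ λ x → ∃ λ y → ∃ (λ a → lookup y a ≡ shift (proj₂ (proj₂ c)) (lookup x a)) ×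
      allRuns (testList c) * den τ ^ k < allPass (testList c) x y * den τ ^ k + 2 * weight τ * allRuns (testList c)
    plantedPair = planted-pair (≡-dec _≟S_) (letters n) ∈-letters
      (proj₁ halfLetters) (proj₂ halfLetters) |letters|>0
      colours combined (λ c → shift (proj₂ (proj₂ c))) (λ c → shift-invariant (proj₂ (proj₂ c)))
      -- In order: f is the numerator of the union bound, e completes 2f to B = `den τ ^ k`, u = 2 ^
      -- k bounds B / f, W exceeds the number of colours, and L counts the doublings.
      (weight τ) (proj₁ remainder) (den τ ^ k) (2 ^ k) (2 ^ n ^ 27) (n ^ 28) (proj₂ remainder)
      (m^n>0 2 k) (weight>0 τ) (den^≤weight τ) length-colours gap
      (rectangles-small k (tests τ) (2^rounds≤N τ) (rounds<N τ) (tests≤N τ)) low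

    conclusion : ∃ λ w → ∃ λ w′ → Fooled (suc τ) F w w′
    conclusion = (w , x) , (w′ , y) , Planted.fooled w w′ σ x y (proj₁ at) (proj₂ at) pass
      where
      w    = proj₁ (proj₁ plantedPair)
      w′   = proj₁ (proj₂ (proj₁ plantedPair))
      σ    = proj₂ (proj₂ (proj₁ plantedPair))
      x    = proj₁ (proj₂ plantedPair)
      y    = proj₁ (proj₂ (proj₂ plantedPair))
      at   = proj₁ (proj₂ (proj₂ (proj₂ plantedPair)))
      pass = proj₂ (proj₂ (proj₂ (proj₂ plantedPair)))

  someCode : ∀ τ → Code τ
  someCode zero    = tt
  someCode (suc τ) = someCode τ , replicate _ (replicate _ (replicate _ true))

  hardness : ∀ τ (F : Families τ) → ∃ λ w → ∃ λ w′ → Fooled τ F w w′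
  hardness zero F = tt , tt , λ i j ()
  hardness (suc τ) F with num (suc τ) ≤? den (suc τ)
  ... | yes a′≤b′ = Step.conclusion τ F (λ x y → hardness τ (restrict F x y)) a′≤b′
  -- No probability exceeds a threshold above 1, so any code will do. This case distinction replaces
  -- a bound on the series of 1/(10 i²).
  ... | no  a′≰b′ = someCode (suc τ) , someCode (suc τ) , λ i j _ _ s _ → begin
    count (F i j) s (someCode (suc τ)) (someCode (suc τ)) * den (suc τ)
      ≤⟨ *-mono-≤ (count≤seeds (F i j) s (someCode (suc τ)) (someCode (suc τ))) (≰⇒≥ a′≰b′) ⟩
    seeds (F i j) * num (suc τ)    ≡⟨ *-comm (seeds (F i j)) (num (suc τ)) ⟩
    num (suc τ) * seeds (F i j)    ∎
    where open ≤-Reasoning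

-- Probabilities

toℚᵘ-/ : ∀ a b .{{_ : NonZero b}} → ℚ.toℚᵘ (ℤ.+ a ℚ./ b) ℚᵘ.≃ ℤ.+ a ℚᵘ./ b
toℚᵘ-/ a (suc b) = ℚ.toℚᵘ-fromℚᵘ (ℚᵘ.mkℚᵘ (ℤ.+ a) b)

/-+-1/ : ∀ a b v .{{_ : NonZero b}} .{{_ : NonZero v}} .{{_ : NonZero (v * b)}} →
         ℤ.+ a ℚᵘ./ b ℚᵘ.+ ℤ.+ 1 ℚᵘ./ v ℚᵘ.≃ ℤ.+ (v * a + b) ℚᵘ./ (v * b)
/-+-1/ a b@(suc _) v@(suc _) = ℚᵘ.*≡* (cong₂ ℤ._*_ numerators (cong ℤ.+_ (*-comm v b)))
  where
  open ≡-Reasoning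
  numerators : ℤ.+ a ℤ.* ℤ.+ v ℤ.+ ℤ.+ 1 ℤ.* ℤ.+ b ≡ ℤ.+ (v * a + b)
  numerators = begin
    ℤ.+ a ℤ.* ℤ.+ v ℤ.+ ℤ.+ 1 ℤ.* ℤ.+ b   ≡⟨ cong₂ ℤ._+_ (ℤ.pos-* a v) (ℤ.pos-* 1 b) ⟨
    ℤ.+ (a * v) ℤ.+ ℤ.+ (1 * b)           ≡⟨ ℤ.pos-+ (a * v) (1 * b) ⟨
    ℤ.+ (a * v + 1 * b)                   ≡⟨ cong ℤ.+_ (cong₂ _+_ (*-comm a v) (*-identityˡ b)) ⟩
    ℤ.+ (v * a + b)                       ∎

cross-< : ∀ a b c d .{{_ : NonZero b}} .{{_ : NonZero d}} → ℤ.+ a ℚᵘ./ b ℚᵘ.< ℤ.+ c ℚᵘ./ d → a * d < c * b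
cross-< a b@(suc _) c d@(suc _) (ℚᵘ.*<* lt) =
  ℤ.drop‿+<+ (subst₂ ℤ._<_ (sym (ℤ.pos-* a d)) (sym (ℤ.pos-* c b)) lt)

-- `P` obeys the recursion of `num` and `den` but reduces the fraction at every addition, hence the
-- comparison up to equivalence of unnormalised rationals.
P≃ : ∀ τ → ℚ.toℚᵘ (P τ) ℚᵘ.≃ (ℤ.+ num (suc τ) ℚᵘ./ den (suc τ)) {{>-nonZero (den>0 (suc τ))}}
P≃ zero    = ℚᵘ.*≡* refl
P≃ (suc τ) = begin
  ℚ.toℚᵘ (P (suc τ))
    ≈⟨ ℚ.toℚᵘ-homo-+ (P τ) (ℤ.+ 1 ℚ./ v) ⟩
  ℚ.toℚᵘ (P τ) ℚᵘ.+ ℚ.toℚᵘ (ℤ.+ 1 ℚ./ v)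
    ≈⟨ ℚᵘ.+-cong (P≃ τ) (toℚᵘ-/ 1 v) ⟩
  (ℤ.+ num (suc τ) ℚᵘ./ den (suc τ)) {{nz}} ℚᵘ.+ ℤ.+ 1 ℚᵘ./ v
    ≈⟨ /-+-1/ (num (suc τ)) (den (suc τ)) v {{nz}} {{_}} {{>-nonZero (den>0 (2 + τ))}} ⟩
  (ℤ.+ num (2 + τ) ℚᵘ./ den (2 + τ)) {{>-nonZero (den>0 (2 + τ))}} ∎
  where
  open SetoidReasoning ℚᵘ.≃-setoid
  v = step (suc τ)
  nz : NonZero (den (suc τ))
  nz = >-nonZero (den>0 (suc τ))

P-not-exceeded : ∀ τ l d .{{_ : NonZero d}} → l * den (suc τ) ≤ num (suc τ) * d → ¬ P τ ℚ.< ℤ.+ l ℚ./ d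
P-not-exceeded τ l d le P<l/d = <⇒≱ (cross-< (num (suc τ)) (den (suc τ)) l d {{>-nonZero (den>0 (suc τ))}}
  (ℚᵘ.<-respˡ-≃ (P≃ τ) (ℚᵘ.<-respʳ-≃ (toℚᵘ-/ l d) (ℚ.toℚᵘ-mono-< P<l/d)))) le

-- Bridges the `Fin`-indexed protocols of the theorem and the ℕ-indexed `Families`, with `d` filling
-- the remaining indices.
extend : ∀ {t} {A : ℕ → Set} → (∀ n → A n) → (f : (i : Fin t) → A (toℕ i)) →
         ∃ λ (g : ∀ n → A n) → ∀ i → g (toℕ i) ≡ f i
extend {zero}  d f = d , λ ()
extend {suc t} {A} d f = g , λ { zero → refl ; (suc i) → proj₂ rest i }
  where
  rest = extend {t} {A ∘ suc} (d ∘ suc) (f ∘ suc)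
  g : ∀ n → A n
  g zero    = f zero
  g (suc n) = proj₁ rest n

constant : ∀ {A B O : Set} {S} → 0 < S → O → Family A B O S
constant S>0 o .rects     = (o , (λ _ → true) , (λ _ → true)) ∷ []
constant S>0 o .seeds     = 1
constant S>0 o .cover _ _ = refl
constant S>0 o .seeds>0   = ≤-refl
constant S>0 o .size      = S>0

theorem4p1 : ∃[ C₀ ] ∀ (C : ℕ) → C₀ ≤ C → ∀ (t : ℕ) → 1 ≤ t →
    (Q : (i : Fin t) → Fin (suc (toℕ i)) → RandProtocol (Inputs C t) (Inputs C t) (BitString (N C (toℕ i)))) →
    (∀ i j → complexity (Q i j) ≤ N C (toℕ i) ^ 4) →
    ∃[ X ] ∃[ Y ] (∀ (i : Fin t) (j : Fin (suc (toℕ i))) →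
    Conclusion (Q i j) X Y (P (t ∸ 1)) (X i) (Y i))
theorem4p1 = 160 , solve
  where
  solve : ∀ C → 160 ≤ C → ∀ t → 1 ≤ t → (Q : (i : Fin t) → _) → (∀ i j → complexity (Q i j) ≤ _) → ∃[ X ] ∃[ Y ] _
  -- The second alternative always holds: no solution exceeds `P τ`, which is `num t / den t` for t
  -- = τ + 1.
  solve C 160≤C t@(suc τ) _ Q Q≤ = input w , input w′ , λ i j → inj₂ (λ s P<Pr sol →
    P-not-exceeded τ (hits i j s) (2 ^ bits (Q i j)) {{m^n≢0 2 (bits (Q i j))}} (bound i j s sol) P<Pr)
    where
    open Hardness C 160≤C

    input : Code t → Inputs C t
    input w ℓ = spread (block t w (toℕ ℓ))

    given : ∀ (i : Fin t) (j : Fin (suc (toℕ i))) → Family (Code t) (Code t) (BitString (N C (toℕ i))) (2 ^ N C (toℕ i) ^ 4)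
    given i j = Family-comap input input (family (Q i j) (Q≤ i j))

    junk : ∀ i → ℕ → Family (Code t) (Code t) (BitString (N C i)) (2 ^ N C i ^ 4)
    junk i _ = constant (m^n>0 2 (N C i ^ 4)) (replicate (N C i) true)

    -- The extension is made in j within each row, and then in i over the rows.
    row : ∀ i → _
    row i = extend (junk (toℕ i)) (given i)

    all-rows : _
    all-rows = extend junk (λ i → proj₁ (row i))

    F : Families t
    F = proj₁ all-rows

    F≡given : ∀ i j → F (toℕ i) (toℕ j) ≡ given i j
    F≡given i j = trans (cong (λ f → f (toℕ j)) (proj₂ all-rows i)) (proj₂ (row i) j)

    found = hardness t F
    w  = proj₁ found
    w′ = proj₁ (proj₂ found)

    hits : ∀ i (j : Fin (suc (toℕ i))) → BitString (N C (toℕ i)) → ℕ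
    hits i j s = length (filter (λ ρ → ≡-dec _≟B_ (run (proto (Q i j) ρ) (input w) (input w′)) s) (allStrings (bits (Q i j))))

    bound : ∀ i j s → IsSolution s (input w i) (input w′ i) → hits i j s * den t ≤ num t * 2 ^ bits (Q i j)
    bound i j s sol = subst (λ c → c * den t ≤ num t * 2 ^ bits (Q i j))
      (trans (count-comap input input (family (Q i j) (Q≤ i j)) s w w′) (count-family (Q i j) (Q≤ i j) s (input w) (input w′)))
      (subst (λ G → count G s w w′ * den t ≤ num t * seeds G) (F≡given i j)
        (proj₂ (proj₂ found) (toℕ i) (toℕ j) (toℕ<n i) (≤-pred (toℕ<n j)) s sol))
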